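{- Let $\mathcal{T}$ be a class of finite undirected trees. The following statements are equivalent: (1) $\mathcal{T}$ is $\mathrm{MSO}_1$-orderable. (2) $\mathcal{T}$ is $\mathrm{MSO}_2$-orderable. (3) $\mathcal{T}$ has property $\mathsf{SEP}$. (4) There exists a number $d\in\mathbb N$ such that every tree in $\mathcal{T}$ has maximal degree at most $d$.
   Context: For a graph $G=\langle V,E\rangle$, $\lfloor G\rfloor=\langle V,\mathrm{edg}\rangle$ is the structure with universe $V$ and the edge relation, and $\lceil G\rceil=\langle V\cup E,\mathrm{inc}\rangle$ is the structure whose universe consists of vertices and edges with the vertex–edge incidence relation. An MSO-formula $\varphi(x,y;\bar Z)$ ($\bar Z$ a tuple of set variables) defines an order on a class of finite structures if for every nonempty structure $\mathfrak A$ in the class there are sets $\bar P$ of elements such that $\{(a,b):\mathfrak A\models\varphi(a,b;\bar P)\}$ is a linear order on the universe. A class $\mathcal C$ of graphs is $\mathrm{MSO}_1$-orderable (resp. $\mathrm{MSO}_2$-orderable) if some MSO-formula defines an order on $\{\lfloor G\rfloor:G\in\mathcal C\}$ (resp. on $\{\lceil G\rceil:G\in\mathcal C\}$). $\mathrm{Sep}(G,k)$ denotes the maximal number of connected components of $G-S$ over all vertex sets $S$ with $|S|\le k$; $\mathcal C$ has property $\mathsf{SEP}$ if there is $f:\mathbb N\to\mathbb N$ with $\mathrm{Sep}(G,k)\le f(k)$ for all $G\in\mathcal C$ and $k\in\mathbb N$. -}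

module Defs where

open import Data.Nat using (ℕ; zero; suc; _≤_; _<_)
open import Data.Fin using (Fin; _≟_; _<?_)
import Data.Fin as F
open import Data.Bool using (Bool; true; false; _∧_; _∨_; not)
open import Data.Bool.ListAction using (any)
open import Data.List using (List; []; _∷_; allFin; length; _++_; [_])
open import Data.List.Relation.Unary.Unique.Propositional using (Unique)
open import Data.List.Relation.Unary.Linked using (Linked)
open import Data.Vec.Functional using (Vector) renaming (_∷_ to _▷_; [] to ε)
open import Data.Product using (Σ; _×_; _,_; ∃; ∃-syntax)
open import Data.Sum using (_⊎_; inj₁; inj₂)
open import Data.Empty using (⊥)
open import Relation.Nullary using (¬_)
open import Relation.Nullary.Decidable using (⌊_⌋)
open import Relation.Binary.PropositionalEquality using (_≡_)
open import Relation.Binary.Structures using (IsTotalOrder)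
open import Function.Bundles using (_⇔_)

record Graph (n : ℕ) : Set where
  field
    adj    : Fin n → Fin n → Bool
    sym    : ∀ u v → adj u v ≡ adj v u
    irrefl : ∀ v → adj v v ≡ false
open Graph public

countᵇ : {A : Set} → (A → Bool) → List A → ℕ
countᵇ p []       = 0
countᵇ p (x ∷ xs) with p x
... | true  = suc (countᵇ p xs)
... | false = countᵇ p xs

degree : ∀ {n} → Graph n → Fin n → ℕ
degree {n} G v = countᵇ (adj G v) (allFin n)

∣_∣ˢ : ∀ {n} → (Fin n → Bool) → ℕ
∣_∣ˢ {n} S = countᵇ S (allFin n)

adjWithout : ∀ {n} → Graph n → (Fin n → Bool) → Fin n → Fin n → Bool
adjWithout G S u v = not (S u) ∧ not (S v) ∧ adj G u v

-- reachᵏ G S k u v : there is a walk of length ≤ k from u to v in G - S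
-- (for u ∉ S)
reach : ∀ {n} → Graph n → (Fin n → Bool) → ℕ → Fin n → Fin n → Bool
reach G S zero    u v = ⌊ u ≟ v ⌋
reach {n} G S (suc k) u v =
  reach G S k u v ∨ any (λ w → reach G S k u w ∧ adjWithout G S w v) (allFin n)

sameComp : ∀ {n} → Graph n → (Fin n → Bool) → Fin n → Fin n → Bool
sameComp {n} G S u v = not (S u) ∧ not (S v) ∧ reach G S n u v

-- number of connected components of G - S: count the vertices of G - S
-- that are the least (in the order of Fin n) vertex of their component
components : ∀ {n} → Graph n → (Fin n → Bool) → ℕ
components {n} G S =
  countᵇ (λ v → not (S v) ∧ not (any (λ w → ⌊ w <? v ⌋ ∧ sameComp G S w v) (allFin n)))
         (allFin n)

noVertex : ∀ {n} → Fin n → Bool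
noVertex _ = false

Connected : ∀ {n} → Graph n → Set
Connected {n} G = ∀ u v → reach G noVertex n u v ≡ true

Edge : ∀ {n} → Graph n → Fin n → Fin n → Set
Edge G u v = adj G u v ≡ true

IsCycle : ∀ {n} → Graph n → Fin n → List (Fin n) → Set
IsCycle G v ws = (2 ≤ length ws) × Unique (v ∷ ws) × Linked (Edge G) (v ∷ ws ++ [ v ])

Acyclic : ∀ {n} → Graph n → Set
Acyclic G = ∀ v ws → ¬ IsCycle G v ws

IsTree : ∀ {n} → Graph n → Set
IsTree {n} G = (0 < n) × Connected G × Acyclic G

GraphClass : Set₁
GraphClass = ∀ n → Graph n → Set

record Structure : Set₁ where
  field
    U : Set
    R : U → U → Set
open Structure public

-- MSO formulas with i free first-order and j free set variables (de Bruijn)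
data Formula (i j : ℕ) : Set where
  eq    : Fin i → Fin i → Formula i j
  rel   : Fin i → Fin i → Formula i j
  mem   : Fin i → Fin j → Formula i j
  neg   : Formula i j → Formula i j
  and   : Formula i j → Formula i j → Formula i j
  or    : Formula i j → Formula i j → Formula i j
  ex₁   : Formula (suc i) j → Formula i j
  all₁  : Formula (suc i) j → Formula i j
  ex₂   : Formula i (suc j) → Formula i j
  all₂  : Formula i (suc j) → Formula i j

Sat : ∀ {i j} (A : Structure) → Formula i j →
      (Fin i → U A) → (Fin j → (U A → Bool)) → Set
Sat A (eq x y)  ρ σ = ρ x ≡ ρ y
Sat A (rel x y) ρ σ = R A (ρ x) (ρ y)
Sat A (mem x X) ρ σ = σ X (ρ x) ≡ true
Sat A (neg φ)   ρ σ = ¬ Sat A φ ρ σ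
Sat A (and φ ψ) ρ σ = Sat A φ ρ σ × Sat A ψ ρ σ
Sat A (or φ ψ)  ρ σ = Sat A φ ρ σ ⊎ Sat A ψ ρ σ
Sat A (ex₁ φ)   ρ σ = Σ (U A) λ a → Sat A φ (a ▷ ρ) σ
Sat A (all₁ φ)  ρ σ = (a : U A) → Sat A φ (a ▷ ρ) σ
Sat A (ex₂ φ)   ρ σ = Σ (U A → Bool) λ P → Sat A φ ρ (P ▷ σ)
Sat A (all₂ φ)  ρ σ = (P : U A → Bool) → Sat A φ ρ (P ▷ σ)

DefinesOrder : ∀ {k} → Formula 2 k → (∀ n → Graph n → Structure) → GraphClass → Set
DefinesOrder {k} φ S C =
  ∀ n (G : Graph n) → C n G → U (S n G) →
    ∃[ P ] IsTotalOrder _≡_ (λ a b → Sat (S n G) φ (a ▷ (b ▷ ε)) P)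

⌊_⌋ᴳ : ∀ {n} → Graph n → Structure
⌊_⌋ᴳ {n} G = record { U = Fin n ; R = Edge G }

EdgeOf : ∀ {n} → Graph n → Set
EdgeOf {n} G = Σ (Fin n × Fin n) λ { (u , v) → (u F.< v) × Edge G u v }

Inc : ∀ {n} (G : Graph n) → Fin n ⊎ EdgeOf G → Fin n ⊎ EdgeOf G → Set
Inc G (inj₁ x) (inj₂ ((u , v) , _)) = (x ≡ u) ⊎ (x ≡ v)
Inc G _        _                    = ⊥

⌈_⌉ᴳ : ∀ {n} → Graph n → Structure
⌈_⌉ᴳ {n} G = record { U = Fin n ⊎ EdgeOf G ; R = Inc G }

MSO₁-orderable : GraphClass → Set
MSO₁-orderable C = ∃[ k ] Σ (Formula 2 k) λ φ → DefinesOrder φ (λ n G → ⌊ G ⌋ᴳ) C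

MSO₂-orderable : GraphClass → Set
MSO₂-orderable C = ∃[ k ] Σ (Formula 2 k) λ φ → DefinesOrder φ (λ n G → ⌈ G ⌉ᴳ) C

-- property SEP: Sep(G,k) ≤ f k, i.e. every S with |S| ≤ k leaves ≤ f k components
SEP : GraphClass → Set
SEP C = Σ (ℕ → ℕ) λ f → ∀ n (G : Graph n) → C n G →
          ∀ k (S : Fin n → Bool) → ∣ S ∣ˢ ≤ k → components G S ≤ f k

BoundedDegree : GraphClass → Set
BoundedDegree C = ∃[ d ] (∀ n (G : Graph n) → C n G → ∀ v → degree G v ≤ d)

{-# OPTIONS --safe #-}
-- Bounded degree gives an order: root the tree, mark the depths modulo 3 so that the parent relation
-- becomes definable, and mark the siblings by rank; depth-first order is then definable. The incidence
-- structure is the subdivision of the tree, which is again a tree of bounded degree, so the same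
-- formula orders it.
--
-- Conversely, fix φ and a vertex v. Every branch at v has a φ-type, one of finitely many (their number
-- depends on φ only). If two branches had the same type, exchanging them would be a winning
-- strategy in the Ehrenfeucht–Fraïssé game, so φ(a, b) and φ(b, a) would agree on their roots a and b,
-- against antisymmetry. Hence the degree of v is bounded by the number of types.
--
-- Finally G - v has at least deg v components, one for each neighbour, while every component of G - S
-- contains a fixed root or a neighbour of S.
module Submission where

open import Defs renaming (sym to adj-sym; irrefl to adj-irrefl)
open import Axiom.UniquenessOfIdentityProofs using (module Decidable⇒UIP)
open import Data.Bool using (Bool; true; false; _∧_; _∨_; not)
open import Data.Bool.ListAction using (any)
import Data.Bool.Properties as 𝔹
open import Data.Fin as F using (Fin; zero; suc; toℕ; fromℕ<)
open import Data.Fin.Patterns using (0F; 1F; 2F; 3F; 4F)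
import Data.Fin.Properties as F
open import Data.List using (List; []; _∷_; allFin; length; _++_; [_])
open import Data.List.Membership.Propositional using (_∈_; lose)
open import Data.List.Membership.Propositional.Properties using (∈-allFin)
open import Data.List.Properties using (length-++)
open import Data.List.Relation.Unary.All as All using (All; []; _∷_)
import Data.List.Relation.Unary.All.Properties as All
open import Data.List.Relation.Unary.AllPairs using ([]; _∷_)
open import Data.List.Relation.Unary.Any using (here; there; satisfied)
open import Data.List.Relation.Unary.Any.Properties using (any⁺; any⁻)
open import Data.List.Relation.Unary.Linked using (Linked; [-]; _∷_)
open import Data.List.Relation.Unary.Unique.Propositional using (Unique)
import Data.List.Relation.Unary.Unique.Propositional.Properties as Unique
open import Data.Nat
  using (ℕ; zero; suc; _+_; _*_; _^_; _≤_; _<_; z≤n; s≤s; _≤′_; ≤′-reflexive; ≤′-step)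
import Data.Nat.Properties as ℕ
open import Data.Product using (_×_; _,_; ∃-syntax; proj₁; proj₂)
open import Data.Sum as Sum using (_⊎_; inj₁; inj₂; swap)
import Data.Sum.Properties as Sum
open import Data.Vec.Functional using () renaming (_∷_ to _▷_; [] to ε)
open import Function using (id; _∘_)
open import Function.Bundles using (_⇔_; Equivalence; mk⇔)
open import Relation.Binary.Definitions using (tri<; tri≈; tri>)
open import Relation.Binary.PropositionalEquality
  using (_≡_; _≢_; refl; sym; trans; cong; cong₂; subst; isEquivalence; module ≡-Reasoning)
open import Relation.Binary.Structures using (IsTotalOrder)
open import Relation.Nullary using (¬_; Dec; yes; no; contradiction)
open import Relation.Nullary.Decidable using (⌊_⌋; decidable-stable; map′; _⊎-dec_)

-- Equal types do not make two branches isomorphic: the branches may differ in shape and carry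
-- different traces of the parameters. The exchange is therefore a relation between game positions
-- rather than a map of the tree, and its answers are read off from the types one move at a time. A
-- type is a number computed by recursion on the formula, below a bound that depends on the formula
-- alone. Satisfaction is only carried from one position to the other and never decided, which suits
-- a constructive `Sat`. Each of the two branches contains just one of the elements compared by the
-- order: it sees that element in the first or in the second place, and the other one merely as
-- lying outside. So a branch is classified by two types, and the degree bound is
-- `typeCount φ * typeCount φ`. The relation survives the exchange because a branch meets the rest
-- of the tree in a single pair, its top and the root. Both directions are carried out for any
-- structure with a `RootedTree`, so that graphs and their incidence structures share one argument.

∧-split : ∀ {a b} → a ∧ b ≡ true → a ≡ true × b ≡ true
∧-split {true} q = refl , q

∧-join : ∀ {a b} → a ≡ true → b ≡ true → a ∧ b ≡ true
∧-join refl q = q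

∨-split : ∀ {a b} → a ∨ b ≡ true → a ≡ true ⊎ b ≡ true
∨-split {true}  _ = inj₁ refl
∨-split {false} q = inj₂ q

∨-inʳ : ∀ a {b} → b ≡ true → a ∨ b ≡ true
∨-inʳ true  _ = refl
∨-inʳ false q = q

not-true : ∀ {a} → not a ≡ true → a ≡ false
not-true {false} _ = refl

true≢false : ∀ {a} → a ≡ true → a ≢ false
true≢false refl ()

module _ {ℓ} {A : Set ℓ} where
  ⌊⌋-true : {a? : Dec A} → A → ⌊ a? ⌋ ≡ true
  ⌊⌋-true {yes _} _ = refl
  ⌊⌋-true {no ¬a} a = contradiction a ¬a

  ⌊⌋-false : {a? : Dec A} → ¬ A → ⌊ a? ⌋ ≡ false
  ⌊⌋-false {yes a} ¬a = contradiction a ¬a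
  ⌊⌋-false {no _}  _  = refl

  ⌊⌋-elim : {a? : Dec A} → ⌊ a? ⌋ ≡ true → A
  ⌊⌋-elim {yes a} _ = a

  ⌊⌋-elim-false : {a? : Dec A} → ⌊ a? ⌋ ≡ false → ¬ A
  ⌊⌋-elim-false {no ¬a} _ = ¬a

⌊⌋-cong : ∀ {a b} {A : Set a} {B : Set b} {a? : Dec A} {b? : Dec B} →
          (A → B) → (B → A) → ⌊ a? ⌋ ≡ ⌊ b? ⌋
⌊⌋-cong {a? = yes a} f g = sym (⌊⌋-true (f a))
⌊⌋-cong {a? = no ¬a} f g = sym (⌊⌋-false (¬a ∘ g))

any-intro : ∀ {n} (p : Fin n → Bool) {x} → p x ≡ true → any p (allFin n) ≡ true
any-intro p {x} px =
  Equivalence.to 𝔹.T-≡ (any⁺ p (lose (∈-allFin x) (Equivalence.from 𝔹.T-≡ px)))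

any-elim : ∀ {n} (p : Fin n → Bool) → any p (allFin n) ≡ true → ∃[ x ] p x ≡ true
any-elim {n} p q with satisfied (any⁻ p (allFin n) (Equivalence.from 𝔹.T-≡ q))
... | x , Tpx = x , Equivalence.to 𝔹.T-≡ Tpx

-- Counting and ranking the elements of a Boolean set

member : {A : Set} (p : A → Bool) (xs : List A) → Fin (countᵇ p xs) → A
member p (x ∷ xs) i with p x
member p (x ∷ xs) zero    | true  = x
member p (x ∷ xs) (suc i) | true  = member p xs i
member p (x ∷ xs) i       | false = member p xs i

member-true : {A : Set} (p : A → Bool) (xs : List A) → ∀ i → p (member p xs i) ≡ true
member-true p (x ∷ xs) i with p x in px
member-true p (x ∷ xs) zero    | true  = px
member-true p (x ∷ xs) (suc i) | true  = member-true p xs i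
member-true p (x ∷ xs) i       | false = member-true p xs i

member-∈ : {A : Set} (p : A → Bool) (xs : List A) → ∀ i → member p xs i ∈ xs
member-∈ p (x ∷ xs) i with p x
member-∈ p (x ∷ xs) zero    | true  = here refl
member-∈ p (x ∷ xs) (suc i) | true  = there (member-∈ p xs i)
member-∈ p (x ∷ xs) i       | false = there (member-∈ p xs i)

member-injective : {A : Set} (p : A → Bool) {xs : List A} → Unique xs →
                   ∀ i j → member p xs i ≡ member p xs j → i ≡ j
member-injective p {x ∷ xs} (x∉ ∷ u) i j q with p x
member-injective p (x∉ ∷ u) zero zero q | true = refl
member-injective p {x ∷ xs} (x∉ ∷ u) zero (suc j) q | true =
  contradiction q (All.lookup x∉ (member-∈ p xs j))
member-injective p {x ∷ xs} (x∉ ∷ u) (suc i) zero q | true =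
  contradiction (sym q) (All.lookup x∉ (member-∈ p xs i))
member-injective p (x∉ ∷ u) (suc i) (suc j) q | true = cong suc (member-injective p u i j q)
member-injective p (x∉ ∷ u) i j q | false = member-injective p u i j q

-- The pigeonhole bound behind every numerical estimate below. The code `f` may use the membership
-- proof, and injectivity is asked across any two proofs, so no irrelevance of proofs is involved.
countᵇ-≤ : ∀ {n m} (p : Fin n → Bool) (f : ∀ x → p x ≡ true → Fin m) →
           (∀ {x y} px py → f x px ≡ f y py → x ≡ y) → countᵇ p (allFin n) ≤ m
countᵇ-≤ {n} p f inj = F.injective⇒≤ λ {i} {j} q →
  member-injective p (Unique.allFin⁺ n) i j
    (inj (member-true p (allFin n) i) (member-true p (allFin n) j) q)

position : ∀ {n} → (Fin n → Bool) → List (Fin n) → Fin n → ℕ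
position p []       x = zero
position p (y ∷ ys) x with x F.≟ y | p y
... | yes _ | _     = zero
... | no _  | true  = suc (position p ys x)
... | no _  | false = position p ys x

position-≤ : ∀ {n} (p : Fin n → Bool) xs x → position p xs x ≤ countᵇ p xs
position-≤ p []       x = z≤n
position-≤ p (y ∷ ys) x with x F.≟ y | p y
... | yes _ | _     = z≤n
... | no _  | true  = s≤s (position-≤ p ys x)
... | no _  | false = position-≤ p ys x

position-< : ∀ {n} (p : Fin n → Bool) {xs x} → x ∈ xs → p x ≡ true →
             position p xs x < countᵇ p xs
position-< p {y ∷ ys} {x} x∈ px with x F.≟ y | p y in py
position-< p x∈ px | yes refl | true  = s≤s z≤n
position-< p x∈ px | yes refl | false = contradiction py (true≢false px)
position-< p (here x≡y) px | no x≢y | _ = contradiction x≡y x≢y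
position-< p (there x∈) px | no x≢y | true  = s≤s (position-< p x∈ px)
position-< p (there x∈) px | no x≢y | false = position-< p x∈ px

position-injective : ∀ {n} (p : Fin n → Bool) {xs x y} → x ∈ xs → y ∈ xs →
                     p x ≡ true → p y ≡ true → position p xs x ≡ position p xs y → x ≡ y
position-injective p {z ∷ zs} {x} {y} x∈ y∈ px py q with x F.≟ z | y F.≟ z | p z in pz
... | yes refl | yes refl | _     = refl
... | yes refl | no _     | false = contradiction pz (true≢false px)
... | no _     | yes refl | false = contradiction pz (true≢false py)
position-injective p (here x≡z) _ _ _ _ | no x≢z | _ | _ = contradiction x≡z x≢z
position-injective p _ (here y≡z) _ _ _ | _ | no y≢z | _ = contradiction y≡z y≢z
position-injective p (there x∈) (there y∈) px py q | no _ | no _ | true =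
  position-injective p x∈ y∈ px py (ℕ.suc-injective q)
position-injective p (there x∈) (there y∈) px py q | no _ | no _ | false =
  position-injective p x∈ y∈ px py q

rankIn : ∀ {n} → (Fin n → Bool) → Fin n → ℕ
rankIn {n} p = position p (allFin n)

rankIn-< : ∀ {n} (p : Fin n → Bool) {x} → p x ≡ true → rankIn p x < countᵇ p (allFin n)
rankIn-< p {x} = position-< p (∈-allFin x)

rankIn-injective : ∀ {n} (p : Fin n → Bool) {x y} → p x ≡ true → p y ≡ true →
                   rankIn p x ≡ rankIn p y → x ≡ y
rankIn-injective p {x} {y} = position-injective p (∈-allFin x) (∈-allFin y)

code : ∀ {n k} (p : Fin n → Bool) → countᵇ p (allFin n) ≤ k → ∀ {x} → p x ≡ true → Fin k
code p ≤k px = fromℕ< (ℕ.<-≤-trans (rankIn-< p px) ≤k)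

code-injective : ∀ {n k} (p : Fin n → Bool) (≤k : countᵇ p (allFin n) ≤ k) {x y}
                 (px : p x ≡ true) (py : p y ≡ true) → code p ≤k px ≡ code p ≤k py → x ≡ y
code-injective p ≤k px py q = rankIn-injective p px py (F.fromℕ<-injective _ _ _ _ q)

-- Rooted trees and their depth-first order

record FiniteDec (A : Structure) : Set where
  field
    size     : ℕ
    enum     : Fin size → U A
    idx      : U A → Fin size
    enum-idx : ∀ u → enum (idx u) ≡ u
    rel?     : ∀ u v → Dec (R A u v)

  _≟ᵁ_ : (u v : U A) → Dec (u ≡ v)
  u ≟ᵁ v = map′ (λ q → trans (sym (enum-idx u)) (trans (cong enum q) (enum-idx v)))
                (cong idx) (idx u F.≟ idx v)

-- The direction of `R` is left independent of the direction of the tree, so that the record fits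
-- both the symmetric adjacency and the incidence relation, which only leads from vertices to edges.
record RootedTree (A : Structure) : Set where
  field
    root         : U A
    parent       : U A → U A
    depth        : U A → ℕ
    depth-root   : depth root ≡ 0
    depth-zero   : ∀ {x} → depth x ≡ 0 → x ≡ root
    depth-parent : ∀ {x k} → depth x ≡ suc k → depth (parent x) ≡ k

  infix 4 _◁_
  -- The clause on depths keeps the root from being a child: `parent root` is an arbitrary value.
  _◁_ : U A → U A → Set
  x ◁ y = parent y ≡ x × depth y ≡ suc (depth x)

  field
    rel⇒◁ : ∀ {x y} → R A x y → x ◁ y ⊎ y ◁ x
    ◁⇒rel : ∀ {x y} → x ◁ y → R A x y ⊎ R A y x

  ◁-unique : ∀ {x y z} → x ◁ z → y ◁ z → x ≡ y
  ◁-unique (p , _) (q , _) = trans (sym p) q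

  parent-◁ : ∀ {x k} → depth x ≡ suc k → parent x ◁ x
  parent-◁ q = refl , trans q (cong suc (sym (depth-parent q)))

  root-or-child : ∀ x → x ≡ root ⊎ parent x ◁ x
  root-or-child x with depth x in q
  ... | zero  = inj₁ (depth-zero q)
  ... | suc k = inj₂ (refl , cong suc (sym (depth-parent q)))

  data Anc (x : U A) : U A → Set where
    here  : Anc x x
    there : ∀ {y z} → Anc x y → y ◁ z → Anc x z

  anc-trans : ∀ {x y z} → Anc x y → Anc y z → Anc x z
  anc-trans p here        = p
  anc-trans p (there q c) = there (anc-trans p q) c

  anc-depth : ∀ {x y} → Anc x y → depth x ≤ depth y
  anc-depth here = ℕ.≤-refl
  anc-depth (there p (_ , q)) =
    ℕ.≤-trans (anc-depth p) (ℕ.≤-trans (ℕ.n≤1+n _) (ℕ.≤-reflexive (sym q)))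

  private
    root-anc′ : ∀ k {x} → depth x ≡ k → Anc root x
    root-anc′ zero    q = subst (Anc root) (sym (depth-zero q)) here
    root-anc′ (suc k) q = there (root-anc′ k (depth-parent q)) (parent-◁ q)

  root-anc : ∀ x → Anc root x
  root-anc x = root-anc′ (depth x) refl

  ◁-¬anc : ∀ {x y} → x ◁ y → ¬ Anc y x
  ◁-¬anc (_ , q) p = ℕ.<-irrefl refl (ℕ.≤-trans (ℕ.≤-reflexive (sym q)) (anc-depth p))

  anc-antisym : ∀ {x y} → Anc x y → Anc y x → x ≡ y
  anc-antisym here        q = refl
  anc-antisym (there p c) q = contradiction (anc-trans q p) (◁-¬anc c)

  anc-parent : ∀ {x y z} → Anc x z → y ◁ z → x ≡ z ⊎ Anc x y
  anc-parent here        c′ = inj₁ refl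
  anc-parent (there p c) c′ = inj₂ (subst (Anc _) (◁-unique c c′) p)

  anc-compare : ∀ {x y u} → Anc x u → Anc y u → Anc x y ⊎ Anc y x
  anc-compare here        q           = inj₂ q
  anc-compare p           here        = inj₁ p
  anc-compare (there p c) (there q c′) = anc-compare p (subst (Anc _) (◁-unique c′ c) q)

  siblings-incomparable : ∀ {x y z} → z ◁ x → z ◁ y → Anc x y → x ≡ y
  siblings-incomparable zx zy xy with anc-parent xy zy
  ... | inj₁ x≡y = x≡y
  ... | inj₂ xz  = contradiction xz (◁-¬anc zx)

  siblings-separate : ∀ {x y z u} → z ◁ x → z ◁ y → Anc x u → Anc y u → x ≡ y
  siblings-separate zx zy xu yu with anc-compare xu yu
  ... | inj₁ xy = siblings-incomparable zx zy xy
  ... | inj₂ yx = sym (siblings-incomparable zy zx yx)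

  data Diverge (u v : U A) : Set where
    diverge : ∀ {x y z} → z ◁ x → z ◁ y → x ≢ y → Anc x u → Anc y v → Diverge u v

  module _ (_≟_ : (u v : U A) → Dec (u ≡ v)) where
    private
      anc?′ : ∀ k x y → depth y ≡ k → Dec (Anc x y)
      anc?′ k x y q with x ≟ y
      ... | yes refl = yes here
      anc?′ zero x y q | no x≢y = no λ p →
        x≢y (anc-antisym p (subst (λ t → Anc t x) (sym (depth-zero q)) (root-anc x)))
      anc?′ (suc k) x y q | no x≢y = map′ (λ p → there p (parent-◁ q)) up
        (anc?′ k x (parent y) (depth-parent q))
        where
        up : Anc x y → Anc x (parent y)
        up p with anc-parent p (parent-◁ q)
        ... | inj₁ x≡y = contradiction x≡y x≢y
        ... | inj₂ r   = r

    anc? : ∀ x y → Dec (Anc x y)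
    anc? x y = anc?′ (depth y) x y refl

    private
      child-towards : ∀ {x u} → Anc x u → x ≡ u ⊎ ∃[ c ] (x ◁ c × Anc c u)
      child-towards here = inj₁ refl
      child-towards (there p c) with child-towards p
      ... | inj₁ refl          = inj₂ (_ , c , here)
      ... | inj₂ (b , xb , bu) = inj₂ (b , xb , there bu c)

      -- Induction climbs from `u`. Only when the parent of `u` is an ancestor of `v` does something
      -- new happen: the child of that parent on the way to `v` is then compared with `u`, and the
      -- two either agree or witness the divergence.
      trichotomy′ : ∀ k {u} v → depth u ≡ k → Anc u v ⊎ Anc v u ⊎ Diverge u v
      trichotomy′ zero    v q = inj₁ (subst (λ u → Anc u v) (sym (depth-zero q)) (root-anc v))
      trichotomy′ (suc k) {u} v q with trichotomy′ k v (depth-parent q)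
      ... | inj₂ (inj₁ p) = inj₂ (inj₁ (there p (parent-◁ q)))
      ... | inj₂ (inj₂ (diverge zx zy x≢y xu yv)) =
        inj₂ (inj₂ (diverge zx zy x≢y (there xu (parent-◁ q)) yv))
      ... | inj₁ p with child-towards p
      ... | inj₁ refl = inj₂ (inj₁ (there here (parent-◁ q)))
      ... | inj₂ (c , pc , cv) with u ≟ c
      ... | yes refl = inj₁ cv
      ... | no u≢c   = inj₂ (inj₂ (diverge (parent-◁ q) pc u≢c here cv))

    trichotomy : ∀ u v → Anc u v ⊎ Anc v u ⊎ Diverge u v
    trichotomy u v = trichotomy′ (depth u) v refl

  module Preorder (rank : U A → ℕ)
                  (rank-injective : ∀ {x y z} → z ◁ x → z ◁ y → rank x ≡ rank y → x ≡ y) where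

    LeftOf : U A → U A → Set
    LeftOf u v = ∃[ x ] ∃[ y ] ∃[ z ] (z ◁ x × z ◁ y × rank x < rank y × Anc x u × Anc y v)

    _⊑_ : U A → U A → Set
    u ⊑ v = Anc u v ⊎ LeftOf u v

    -- The vertices `y` and `x′` are both ancestors of `v`, hence comparable. If they are equal,
    -- both divergences happen below the same vertex and the ranks compose. Otherwise the divergence
    -- nearer to the root already separates `u` from `w`.
    leftOf-trans : ∀ {u v w} → LeftOf u v → LeftOf v w → LeftOf u w
    leftOf-trans (x , y , z , zx , zy , x<y , xu , yv) (x′ , y′ , z′ , zx′ , zy′ , x<y′ , xv , yw)
      with anc-compare yv xv
    ... | inj₁ yx′ with anc-parent yx′ zx′
    ... | inj₂ yz′ = x , y , z , zx , zy , x<y , xu , anc-trans (there yz′ zy′) yw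
    ... | inj₁ refl with ◁-unique zx′ zy
    ... | refl = x , y′ , z , zx , zy′ , ℕ.<-trans x<y x<y′ , xu , yw
    leftOf-trans (x , y , z , zx , zy , x<y , xu , yv) (x′ , y′ , z′ , zx′ , zy′ , x<y′ , xv , yw)
      | inj₂ x′y with anc-parent x′y zy
    ... | inj₂ x′z = x′ , y′ , z′ , zx′ , zy′ , x<y′ , anc-trans (there x′z zx) xu , yw
    ... | inj₁ refl with ◁-unique zx′ zy
    ... | refl = x , y′ , z , zx , zy′ , ℕ.<-trans x<y x<y′ , xu , yw

    ⊑-trans : ∀ {u v w} → u ⊑ v → v ⊑ w → u ⊑ w
    ⊑-trans (inj₁ p) (inj₁ q) = inj₁ (anc-trans p q)
    ⊑-trans (inj₂ p) (inj₂ q) = inj₂ (leftOf-trans p q)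
    ⊑-trans (inj₂ (x , y , z , zx , zy , x<y , xu , yv)) (inj₁ q) =
      inj₂ (x , y , z , zx , zy , x<y , xu , anc-trans yv q)
    ⊑-trans (inj₁ p) (inj₂ (x , y , z , zx , zy , x<y , xv , yw)) with anc-compare xv p
    ... | inj₁ xu = inj₂ (x , y , z , zx , zy , x<y , xu , yw)
    ... | inj₂ ux with anc-parent ux zx
    ... | inj₁ refl = inj₂ (x , y , z , zx , zy , x<y , here , yw)
    ... | inj₂ uz   = inj₁ (anc-trans (there uz zy) yw)

    leftOf-¬anc : ∀ {u v} → LeftOf u v → ¬ Anc v u
    leftOf-¬anc (x , y , z , zx , zy , x<y , xu , yv) vu =
      ℕ.<-irrefl (cong rank (siblings-separate zx zy xu (anc-trans yv vu))) x<y

    leftOf-irrefl : ∀ {u} → ¬ LeftOf u u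
    leftOf-irrefl p = leftOf-¬anc p here

    ⊑-antisym : ∀ {u v} → u ⊑ v → v ⊑ u → u ≡ v
    ⊑-antisym (inj₁ p) (inj₁ q) = anc-antisym p q
    ⊑-antisym (inj₁ p) (inj₂ q) = contradiction p (leftOf-¬anc q)
    ⊑-antisym (inj₂ p) (inj₁ q) = contradiction q (leftOf-¬anc p)
    ⊑-antisym (inj₂ p) (inj₂ q) = contradiction (leftOf-trans p q) leftOf-irrefl

    ⊑-total : ((u v : U A) → Dec (u ≡ v)) → ∀ u v → u ⊑ v ⊎ v ⊑ u
    ⊑-total _≟_ u v with trichotomy _≟_ u v
    ... | inj₁ p        = inj₁ (inj₁ p)
    ... | inj₂ (inj₁ p) = inj₂ (inj₁ p)
    ... | inj₂ (inj₂ (diverge {x} {y} {z} zx zy x≢y xu yv)) with ℕ.<-cmp (rank x) (rank y)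
    ... | tri< x<y _ _ = inj₁ (inj₂ (x , y , z , zx , zy , x<y , xu , yv))
    ... | tri> _ _ y<x = inj₂ (inj₂ (y , x , z , zy , zx , y<x , yv , xu))
    ... | tri≈ _ e _   = contradiction (rank-injective zx zy e) x≢y

    isTotalOrder : ((u v : U A) → Dec (u ≡ v)) → {_≼_ : U A → U A → Set} →
                   (∀ u v → u ≼ v ⇔ u ⊑ v) → IsTotalOrder _≡_ _≼_
    isTotalOrder _≟_ {_≼_} iff = record
      { isPartialOrder = record
        { isPreorder = record
          { isEquivalence = isEquivalence
          ; reflexive     = λ { refl → from (inj₁ here) }
          ; trans         = λ p q → from (⊑-trans (to p) (to q))
          }
        ; antisym = λ p q → ⊑-antisym (to p) (to q)
        }
      ; total = λ u v → Sum.map from from (⊑-total _≟_ u v)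
      }
      where
      to : ∀ {u v} → u ≼ v → u ⊑ v
      to {u} {v} = Equivalence.to (iff u v)
      from : ∀ {u v} → u ⊑ v → u ≼ v
      from {u} {v} = Equivalence.from (iff u v)

-- Defining the depth-first order

cyc : Fin 3 → Fin 3
cyc 0F = 1F
cyc 1F = 2F
cyc 2F = 0F

mod3 : ℕ → Fin 3
mod3 zero    = 0F
mod3 (suc n) = cyc (mod3 n)

-- The reason for the modulus three: were an edge read downwards in both directions, two steps of
-- `cyc` would lead back to the start, as they would modulo two.
cyc-≢ : ∀ c → c ≢ cyc (cyc c)
cyc-≢ 0F ()
cyc-≢ 1F ()
cyc-≢ 2F ()

module _ {i j : ℕ} where
  -- Constructively this yields only the double negation of `ψ`. Each use below has a membership as
  -- `ψ`, which is Boolean and hence stable.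
  imp : Formula i j → Formula i j → Formula i j
  imp φ ψ = neg (and φ (neg ψ))

  stepF : (Fin 3 → Fin j) → Fin i → Fin i → Fin 3 → Formula i j
  stepF D x y c = and (mem x (D c)) (mem y (D (cyc c)))

  -- Adjacent vertices differ in depth by one, so the depths modulo 3 orient each edge.
  parentF : (Fin 3 → Fin j) → Fin i → Fin i → Formula i j
  parentF D x y =
    and (or (rel x y) (rel y x)) (or (stepF D x y 0F) (or (stepF D x y 1F) (stepF D x y 2F)))

  -- The sets `T t` stand for the initial segments of elements with rank at most `t`; a smaller rank
  -- means that some segment contains `x` but not `y`. Ranks range over 0, ..., d, so `d` segments
  -- suffice. The base case is falsity.
  rankLessF : ∀ {d} → (Fin d → Fin j) → Fin i → Fin i → Formula i j
  rankLessF {zero}  T x y = neg (eq x x)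
  rankLessF {suc d} T x y = or (and (mem x (T zero)) (neg (mem y (T zero)))) (rankLessF (T ∘ suc) x y)

-- The usual second-order definition of reachability: every set that contains `x` and is closed
-- under children contains `y`.
ancF : ∀ {i j} → (Fin 3 → Fin j) → Fin i → Fin i → Formula i j
ancF D x y = all₂ (imp (and (mem x zero) closed) (mem y zero))
  where
  closed = all₁ (all₁ (imp (and (mem 1F zero) (parentF (suc ∘ D) 1F 0F)) (mem 0F zero)))

orderF : ∀ d → Formula 2 (3 + d)
orderF d = or (ancF D 0F 1F)
  -- Innermost first, the variables are `z`, `y`, `x` of `LeftOf`, then the two arguments of the
  -- order. The parameters are three residue classes of depths and `d` rank segments.
  (ex₁ (ex₁ (ex₁ (and (parentF D 0F 2F) (and (parentF D 0F 1F)
    (and (rankLessF T 2F 1F) (and (ancF D 2F 3F) (ancF D 1F 4F))))))))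
  where
  D : Fin 3 → Fin (3 + d)
  D c = c F.↑ˡ d
  T : Fin d → Fin (3 + d)
  T t = 3 F.↑ʳ t

module OrderSemantics {A : Structure} (tree : RootedTree A)
                      (_≟_ : (u v : U A) → Dec (u ≡ v)) where
  open RootedTree tree

  mark : Fin 3 → U A → Bool
  mark c u = ⌊ mod3 (depth u) F.≟ c ⌋

  module _ {i j : ℕ} (D : Fin 3 → Fin j) (ρ : Fin i → U A) (σ : Fin j → U A → Bool)
           (marks : ∀ c u → σ (D c) u ≡ mark c u) (x y : Fin i) where

    private
      stepF⇒ : ∀ c → Sat A (stepF D x y c) ρ σ → mod3 (depth (ρ y)) ≡ cyc (mod3 (depth (ρ x)))
      stepF⇒ c (p , q) = trans (⌊⌋-elim (trans (sym (marks (cyc c) _)) q))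
        (cong cyc (sym (⌊⌋-elim (trans (sym (marks c _)) p))))

      stepF⇐ : ∀ c → mod3 (depth (ρ x)) ≡ c → mod3 (depth (ρ y)) ≡ cyc c → Sat A (stepF D x y c) ρ σ
      stepF⇐ c p q = trans (marks c _) (⌊⌋-true p) , trans (marks (cyc c) _) (⌊⌋-true q)

    parentF⇒ : Sat A (parentF D x y) ρ σ → ρ x ◁ ρ y
    parentF⇒ (e , s) = orient (Sum.[ rel⇒◁ , swap ∘ rel⇒◁ ]′ e)
      (Sum.[ stepF⇒ 0F , Sum.[ stepF⇒ 1F , stepF⇒ 2F ]′ ]′ s)
      where
      orient : ρ x ◁ ρ y ⊎ ρ y ◁ ρ x → mod3 (depth (ρ y)) ≡ cyc (mod3 (depth (ρ x))) → ρ x ◁ ρ y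
      orient (inj₁ p)       _ = p
      orient (inj₂ (_ , q)) s =
        contradiction (trans s (cong (cyc ∘ mod3) q)) (cyc-≢ _)

    parentF⇐ : ρ x ◁ ρ y → Sat A (parentF D x y) ρ σ
    parentF⇐ p@(_ , q) = ◁⇒rel p , choose (mod3 (depth (ρ x))) refl
      where
      choose : ∀ c → mod3 (depth (ρ x)) ≡ c →
               Sat A (or (stepF D x y 0F) (or (stepF D x y 1F) (stepF D x y 2F))) ρ σ
      choose c e with c | stepF⇐ c e (trans (cong mod3 q) (cong cyc e))
      ... | 0F | s = inj₁ s
      ... | 1F | s = inj₂ (inj₁ s)
      ... | 2F | s = inj₂ (inj₂ s)

  module _ {i j : ℕ} (D : Fin 3 → Fin j) (ρ : Fin i → U A) (σ : Fin j → U A → Bool)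
           (marks : ∀ c u → σ (D c) u ≡ mark c u) (x y : Fin i) where

    ancF⇒ : Sat A (ancF D x y) ρ σ → Anc (ρ x) (ρ y)
    -- The quantified set is taken to be the set of descendants of `ρ x`, a Boolean set because
    -- ancestry is decidable.
    ancF⇒ s = ⌊⌋-elim (decidable-stable (_ 𝔹.≟ true) λ ∉ → s descendant
      ((⌊⌋-true here , closed) , ∉))
      where
      descendant : U A → Bool
      descendant u = ⌊ anc? _≟_ (ρ x) u ⌋
      closed : ∀ u v → ¬ ((descendant u ≡ true ×
        Sat A (parentF (suc ∘ D) 1F 0F) (v ▷ (u ▷ ρ)) (descendant ▷ σ)) × descendant v ≢ true)
      closed u v ((p , q) , ∉) = ∉ (⌊⌋-true (there (⌊⌋-elim p)
        (parentF⇒ (suc ∘ D) (v ▷ (u ▷ ρ)) (descendant ▷ σ) marks 1F 0F q)))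

    ancF⇐ : Anc (ρ x) (ρ y) → Sat A (ancF D x y) ρ σ
    ancF⇐ p P ((x∈ , closed) , y∉) = y∉ (spread p)
      where
      spread : ∀ {u} → Anc (ρ x) u → P u ≡ true
      spread here = x∈
      spread (there {u} {v} q c) = decidable-stable (_ 𝔹.≟ true) λ ∉ →
        closed u v ((spread q , parentF⇐ (suc ∘ D) (v ▷ (u ▷ ρ)) (P ▷ σ) marks 1F 0F c) , ∉)

  module _ (rank : U A → ℕ) where

    threshold : ∀ {d} → ℕ → Fin d → U A → Bool
    threshold k t u = ⌊ rank u ℕ.≤? k + toℕ t ⌋

    -- The offset `k` counts the segments already discarded, since the recursion passes from `T` to
    -- `T ∘ suc`.
    rankLessF⇒ : ∀ {d i j} (T : Fin d → Fin j) (ρ : Fin i → U A) (σ : Fin j → U A → Bool) x y k →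
                 (∀ t u → σ (T t) u ≡ threshold k t u) →
                 Sat A (rankLessF T x y) ρ σ → rank (ρ x) < rank (ρ y)
    rankLessF⇒ {zero} T ρ σ x y k th s = contradiction refl s
    rankLessF⇒ {suc d} T ρ σ x y k th (inj₁ (p , q)) =
      ℕ.≤-<-trans (⌊⌋-elim (trans (sym (th zero _)) p))
        (ℕ.≰⇒> λ y≤ → q (trans (th zero _) (⌊⌋-true y≤)))
    rankLessF⇒ {suc d} T ρ σ x y k th (inj₂ s) = rankLessF⇒ (T ∘ suc) ρ σ x y (suc k)
      (λ t u → trans (th (suc t) u) (cong (λ b → ⌊ rank u ℕ.≤? b ⌋) (ℕ.+-suc k (toℕ t)))) s

    rankLessF⇐ : ∀ {d i j} (T : Fin d → Fin j) (ρ : Fin i → U A) (σ : Fin j → U A → Bool) x y k →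
                 (∀ t u → σ (T t) u ≡ threshold k t u) → k ≤ rank (ρ x) → rank (ρ y) ≤ k + d →
                 rank (ρ x) < rank (ρ y) → Sat A (rankLessF T x y) ρ σ
    rankLessF⇐ {zero} T ρ σ x y k th k≤x y≤ x<y = contradiction
      (ℕ.<-≤-trans x<y (ℕ.≤-trans y≤ (ℕ.≤-trans (ℕ.≤-reflexive (ℕ.+-identityʳ k)) k≤x)))
      (ℕ.<-irrefl refl)
    rankLessF⇐ {suc d} T ρ σ x y k th k≤x y≤ x<y with rank (ρ x) ℕ.≤? k + 0
    -- Together with `k ≤ rank (ρ x)` this pins the rank of `ρ x` to `k`, so the first remaining
    -- segment separates it from `ρ y`.
    ... | yes x≤ = inj₁ (trans (th zero _) (⌊⌋-true x≤) ,
      λ y∈ → ℕ.<-irrefl refl (ℕ.<-≤-trans x<y (ℕ.≤-trans (⌊⌋-elim (trans (sym (th zero _)) y∈))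
        (ℕ.≤-trans (ℕ.≤-reflexive (ℕ.+-identityʳ k)) k≤x))))
    ... | no x≰ = inj₂ (rankLessF⇐ (T ∘ suc) ρ σ x y (suc k)
      (λ t u → trans (th (suc t) u) (cong (λ b → ⌊ rank u ℕ.≤? b ⌋) (ℕ.+-suc k (toℕ t))))
      (subst (_< _) (ℕ.+-identityʳ k) (ℕ.≰⇒> x≰)) (ℕ.≤-trans y≤ (ℕ.≤-reflexive (ℕ.+-suc k d))) x<y)

  module _ {d} (rank : U A → ℕ) (rank-≤ : ∀ {x} → rank x ≤ d)
           (rank-injective : ∀ {x y z} → z ◁ x → z ◁ y → rank x ≡ rank y → x ≡ y) where
    open Preorder rank rank-injective

    parameters : Fin (3 + d) → U A → Bool
    parameters = mark 0F ▷ (mark 1F ▷ (mark 2F ▷ threshold rank 0))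

    private
      marks : ∀ c u → parameters (c F.↑ˡ d) u ≡ mark c u
      marks 0F u = refl
      marks 1F u = refl
      marks 2F u = refl

    orderF-⊑ : ∀ u v → Sat A (orderF d) (u ▷ (v ▷ ε)) parameters ⇔ (u ⊑ v)
    orderF-⊑ u v = mk⇔ to from
      where
      D : Fin 3 → Fin (3 + d)
      D c = c F.↑ˡ d
      ρ : Fin 2 → U A
      ρ = u ▷ (v ▷ ε)
      to : Sat A (orderF d) ρ parameters → u ⊑ v
      to (inj₁ s) = inj₁ (ancF⇒ D ρ parameters marks 0F 1F s)
      to (inj₂ (x , y , z , zx , zy , x<y , xu , yv)) = inj₂
        ( x , y , z , parentF⇒ D ρ′ parameters marks 0F 2F zx , parentF⇒ D ρ′ parameters marks 0F 1F zy
        , rankLessF⇒ rank (3 F.↑ʳ_) ρ′ parameters 2F 1F 0 (λ _ _ → refl) x<y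
        , ancF⇒ D ρ′ parameters marks 2F 3F xu , ancF⇒ D ρ′ parameters marks 1F 4F yv)
        where
        ρ′ = z ▷ (y ▷ (x ▷ ρ))
      from : u ⊑ v → Sat A (orderF d) ρ parameters
      from (inj₁ p) = inj₁ (ancF⇐ D ρ parameters marks 0F 1F p)
      from (inj₂ (x , y , z , zx , zy , x<y , xu , yv)) = inj₂
        ( x , y , z , parentF⇐ D ρ′ parameters marks 0F 2F zx , parentF⇐ D ρ′ parameters marks 0F 1F zy
        , rankLessF⇐ rank (3 F.↑ʳ_) ρ′ parameters 2F 1F 0 (λ _ _ → refl) z≤n rank-≤ x<y
        , ancF⇐ D ρ′ parameters marks 2F 3F xu , ancF⇐ D ρ′ parameters marks 1F 4F yv)
        where
        ρ′ = z ▷ (y ▷ (x ▷ ρ))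

    orderF-total : IsTotalOrder _≡_ (λ u v → Sat A (orderF d) (u ▷ (v ▷ ε)) parameters)
    orderF-total = isTotalOrder _≟_ orderF-⊑

-- Types of pieces of a structure

bit : Bool → Fin 2
bit false = zero
bit true  = suc zero

bit-injective : ∀ {a b} → bit a ≡ bit b → a ≡ b
bit-injective {false} {false} _ = refl
bit-injective {true}  {true}  _ = refl

isOne : Fin 2 → Bool
isOne zero    = false
isOne (suc _) = true

isOne-bit : ∀ b → isOne (bit b) ≡ b
isOne-bit false = refl
isOne-bit true  = refl

funToFin-cong : ∀ {m n} {f g : Fin m → Fin n} → (∀ i → f i ≡ g i) → F.funToFin f ≡ F.funToFin g
funToFin-cong {zero}  e = refl
funToFin-cong {suc m} e = cong₂ F.combine (e zero) (funToFin-cong (e ∘ suc))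

hits : ∀ {s m} → (Fin s → Fin m) → Fin m → Bool
hits f t = ⌊ F.any? (λ a → f a F.≟ t) ⌋

-- The set of values of f, as a number below 2 ^ m.
image : ∀ {s m} → (Fin s → Fin m) → Fin (2 ^ m)
image f = F.funToFin (bit ∘ hits f)

image-cong : ∀ {s m} {f g : Fin s → Fin m} → (∀ a → f a ≡ g a) → image f ≡ image g
image-cong {f = f} {g} e = funToFin-cong {f = bit ∘ hits f} {bit ∘ hits g} λ t → cong bit (⌊⌋-cong
  (λ (a , q) → a , trans (sym (e a)) q) (λ (a , q) → a , trans (e a) q))

image-⊆ : ∀ {s s′ m} (f : Fin s → Fin m) (g : Fin s′ → Fin m) →
          image f ≡ image g → ∀ a → ∃[ b ] f a ≡ g b
image-⊆ f g e a = let b , q = ⌊⌋-elim (trans (sym same) (⌊⌋-true (a , refl))) in b , sym q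
  where
  open ≡-Reasoning
  same : hits f (f a) ≡ hits g (f a)
  same = bit-injective (begin
    bit (hits f (f a))         ≡⟨ F.finToFun-funToFin (bit ∘ hits f) (f a) ⟨
    F.finToFun (image f) (f a) ≡⟨ cong (λ c → F.finToFun c (f a)) e ⟩
    F.finToFun (image g) (f a) ≡⟨ F.finToFun-funToFin (bit ∘ hits g) (f a) ⟩
    bit (hits g (f a))         ∎)

-- No structure enters, which makes the final bound uniform. The factor 2 under an element
-- quantifier records whether the chosen element lies in the piece. The three bits of `rel` record
-- the relation inside the piece and, for each argument, whether it is the distinguished element.
typeCount : ∀ {i j} → Formula i j → ℕ
typeCount (eq x y)  = 2
typeCount (rel x y) = 2 * (2 * 2)
typeCount (mem x X) = 2
typeCount (neg φ)   = typeCount φ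
typeCount (and φ ψ) = typeCount φ * typeCount ψ
typeCount (or φ ψ)  = typeCount φ * typeCount ψ
typeCount (ex₁ φ)   = 2 ^ (2 * typeCount φ)
typeCount (all₁ φ)  = 2 ^ (2 * typeCount φ)
typeCount (ex₂ φ)   = 2 ^ typeCount φ
typeCount (all₂ φ)  = 2 ^ typeCount φ

module Types {A : Structure} (fin : FiniteDec A) where
  open FiniteDec fin

  relᵇ : U A → U A → Bool
  relᵇ u v = ⌊ rel? u v ⌋

  decode : Fin (2 ^ size) → U A → Bool
  decode c u = isOne (F.finToFun c (idx u))

  encode : (U A → Bool) → Fin (2 ^ size)
  encode P = F.funToFin (bit ∘ P ∘ enum)

  decode-encode : ∀ P u → decode (encode P) u ≡ P u
  decode-encode P u = begin
    isOne (F.finToFun (encode P) (idx u)) ≡⟨ cong isOne (F.finToFun-funToFin (bit ∘ P ∘ enum) (idx u)) ⟩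
    isOne (bit (P (enum (idx u))))        ≡⟨ isOne-bit _ ⟩
    P (enum (idx u))                      ≡⟨ cong P (enum-idx u) ⟩
    P u                                   ∎
    where open ≡-Reasoning

  -- A formula-driven Hintikka type of the piece W with distinguished element w. Elements outside W
  -- are visible only as being outside, and sets only through their trace on W.
  tp : ∀ {i j} (φ : Formula i j) (W : U A → Bool) (w : U A) →
       (Fin i → U A) → (Fin j → U A → Bool) → Fin (typeCount φ)
  tpElem : ∀ {i j} (φ : Formula (suc i) j) (W : U A → Bool) (w : U A) →
           (Fin i → U A) → (Fin j → U A → Bool) → U A → Fin (2 * typeCount φ)
  tpElem φ W w ρ σ a = F.combine (bit (W a)) (tp φ W w (a ▷ ρ) σ)
  tp (eq x y)  W w ρ σ = bit (W (ρ x) ∧ W (ρ y) ∧ ⌊ ρ x ≟ᵁ ρ y ⌋)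
  -- The last two bits matter for pairs with only one argument in the piece: the distinguished
  -- element alone can be related to the outside.
  tp (rel x y) W w ρ σ = F.combine (bit (W (ρ x) ∧ W (ρ y) ∧ relᵇ (ρ x) (ρ y)))
                           (F.combine (bit ⌊ ρ x ≟ᵁ w ⌋) (bit ⌊ ρ y ≟ᵁ w ⌋))
  tp (mem x X) W w ρ σ = bit (W (ρ x) ∧ σ X (ρ x))
  tp (neg φ)   W w ρ σ = tp φ W w ρ σ
  tp (and φ ψ) W w ρ σ = F.combine (tp φ W w ρ σ) (tp ψ W w ρ σ)
  tp (or φ ψ)  W w ρ σ = F.combine (tp φ W w ρ σ) (tp ψ W w ρ σ)
  tp (ex₁ φ)   W w ρ σ = image (tpElem φ W w ρ σ ∘ enum)
  tp (all₁ φ)  W w ρ σ = image (tpElem φ W w ρ σ ∘ enum)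
  tp (ex₂ φ)   W w ρ σ = image (λ c → tp φ W w ρ (decode c ▷ σ))
  tp (all₂ φ)  W w ρ σ = image (λ c → tp φ W w ρ (decode c ▷ σ))

  SameIn : (U A → Bool) → U A → U A → Set
  SameIn W a b = a ≡ b ⊎ (W a ≡ false × W b ≡ false)

  module _ {W : U A → Bool} {w : U A} (w∈ : W w ≡ true) where

    private
      ∧-sameIn : ∀ {a b} (f g : U A → Bool) → SameIn W a b → (W a ≡ true → f a ≡ g b) →
                 W a ∧ f a ≡ W b ∧ g b
      ∧-sameIn {a} f g (inj₁ refl) e with W a
      ... | true  = e refl
      ... | false = refl
      ∧-sameIn f g (inj₂ (p , q)) e rewrite p | q = refl

      isRoot-sameIn : ∀ {a b} → SameIn W a b → ⌊ a ≟ᵁ w ⌋ ≡ ⌊ b ≟ᵁ w ⌋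
      isRoot-sameIn (inj₁ refl)    = refl
      isRoot-sameIn (inj₂ (p , q)) = trans
        (⌊⌋-false λ { refl → true≢false w∈ p }) (sym (⌊⌋-false λ { refl → true≢false w∈ q }))

      ∧-sameIn₂ : ∀ {a b c d} (r : U A → U A → Bool) → SameIn W a b → SameIn W c d →
                  W a ∧ W c ∧ r a c ≡ W b ∧ W d ∧ r b d
      ∧-sameIn₂ {a} {b} {c} {d} r ab@(inj₁ refl) cd =
        ∧-sameIn (λ a → W c ∧ r a c) (λ b → W d ∧ r b d) ab λ a∈ → inner cd
        where
        inner : SameIn W c d → W c ∧ r a c ≡ W d ∧ r a d
        inner (inj₁ refl)    = refl
        inner cd@(inj₂ (p , q)) rewrite p | q = refl
      ∧-sameIn₂ r (inj₂ (p , q)) cd rewrite p | q = refl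

      ▷-sameIn : ∀ {i} {ρ ρ′ : Fin i → U A} {a b} → SameIn W a b →
                 (∀ x → SameIn W (ρ x) (ρ′ x)) → ∀ x → SameIn W ((a ▷ ρ) x) ((b ▷ ρ′) x)
      ▷-sameIn ab e zero    = ab
      ▷-sameIn ab e (suc x) = e x

      ▷-sameTrace : ∀ {j} {σ σ′ : Fin j → U A → Bool} {P Q : U A → Bool} →
                    (∀ u → W u ≡ true → P u ≡ Q u) →
                    (∀ X u → W u ≡ true → σ X u ≡ σ′ X u) →
                    ∀ X u → W u ≡ true → (P ▷ σ) X u ≡ (Q ▷ σ′) X u
      ▷-sameTrace PQ e zero    = PQ
      ▷-sameTrace PQ e (suc X) = e X

    -- Every atom is guarded by membership in `W`, except the tests for being `w`; these fail for
    -- all outside elements because `w` lies in `W`. The quantifiers preserve the agreement.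
    tp-local : ∀ {i j} (φ : Formula i j) {ρ ρ′ : Fin i → U A} {σ σ′ : Fin j → U A → Bool} →
               (∀ x → SameIn W (ρ x) (ρ′ x)) → (∀ X u → W u ≡ true → σ X u ≡ σ′ X u) →
               tp φ W w ρ σ ≡ tp φ W w ρ′ σ′
    tpElem-local : ∀ {i j} (φ : Formula (suc i) j) {ρ ρ′ : Fin i → U A} {σ σ′ : Fin j → U A → Bool} →
                   (∀ x → SameIn W (ρ x) (ρ′ x)) → (∀ X u → W u ≡ true → σ X u ≡ σ′ X u) →
                   ∀ a → tpElem φ W w ρ σ a ≡ tpElem φ W w ρ′ σ′ a
    tpElem-local φ e s a = cong (F.combine (bit (W a))) (tp-local φ (▷-sameIn (inj₁ refl) e) s)
    tp-local (eq x y)  e s = cong bit (∧-sameIn₂ (λ a b → ⌊ a ≟ᵁ b ⌋) (e x) (e y))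
    tp-local (rel x y) e s = cong₂ F.combine (cong bit (∧-sameIn₂ relᵇ (e x) (e y)))
      (cong₂ F.combine (cong bit (isRoot-sameIn (e x))) (cong bit (isRoot-sameIn (e y))))
    tp-local (mem x X) {ρ} {ρ′} {σ} {σ′} e s = cong bit (∧-sameIn (σ X) (σ′ X) (e x) (trace (e x)))
      where
      trace : ∀ {a b} → SameIn W a b → W a ≡ true → σ X a ≡ σ′ X b
      trace (inj₁ refl)    a∈ = s X _ a∈
      trace (inj₂ (p , _)) a∈ = contradiction p (true≢false a∈)
    tp-local (neg φ)   e s = tp-local φ e s
    tp-local (and φ ψ) e s = cong₂ F.combine (tp-local φ e s) (tp-local ψ e s)
    tp-local (or φ ψ)  e s = cong₂ F.combine (tp-local φ e s) (tp-local ψ e s)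
    tp-local (ex₁ φ)   e s = image-cong (tpElem-local φ e s ∘ enum)
    tp-local (all₁ φ)  e s = image-cong (tpElem-local φ e s ∘ enum)
    tp-local (ex₂ φ)   e s = image-cong λ c → tp-local φ e (▷-sameTrace (λ _ _ → refl) s)
    tp-local (all₂ φ)  e s = image-cong λ c → tp-local φ e (▷-sameTrace (λ _ _ → refl) s)

    tp-set : ∀ {i j} (φ : Formula i (suc j)) {ρ : Fin i → U A} {σ : Fin j → U A → Bool} {P Q} →
             (∀ u → W u ≡ true → P u ≡ Q u) → tp φ W w ρ (P ▷ σ) ≡ tp φ W w ρ (Q ▷ σ)
    tp-set φ PQ = tp-local φ (λ _ → inj₁ refl) (▷-sameTrace PQ (λ _ _ _ → refl))

    tp-outside : ∀ {i j} (φ : Formula (suc i) j) {ρ : Fin i → U A} {σ : Fin j → U A → Bool} {a b} →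
                 W a ≡ false → W b ≡ false → tp φ W w (a ▷ ρ) σ ≡ tp φ W w (b ▷ ρ) σ
    tp-outside φ p q = tp-local φ (▷-sameIn (inj₂ (p , q)) λ _ → inj₁ refl) (λ _ _ _ → refl)

  -- One answer in the game between two pieces. The extra bit of `tpElem` ensures that the answer is
  -- inside its piece exactly when the move is inside its own.
  elem-move : ∀ {i j} (φ : Formula (suc i) j) {W w W′ w′} {ρ ρ′ : Fin i → U A} {σ σ′ : Fin j → U A → Bool} →
              image (tpElem φ W w ρ σ ∘ enum) ≡ image (tpElem φ W′ w′ ρ′ σ′ ∘ enum) →
              ∀ a → ∃[ b ] (W a ≡ W′ b × tp φ W w (a ▷ ρ) σ ≡ tp φ W′ w′ (b ▷ ρ′) σ′)
  elem-move φ {W} {w} {W′} {w′} {ρ} {ρ′} {σ} {σ′} e a =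
    let c , q = image-⊆ (tpElem φ W w ρ σ ∘ enum) (tpElem φ W′ w′ ρ′ σ′ ∘ enum) e (idx a)
        s , t = F.combine-injective (bit (W a)) _ (bit (W′ (enum c))) _
                  (trans (cong (tpElem φ W w ρ σ) (sym (enum-idx a))) q)
    in enum c , bit-injective s , t

  set-move : ∀ {i j} (φ : Formula i (suc j)) {W w W′ w′} {ρ ρ′ : Fin i → U A} {σ σ′ : Fin j → U A → Bool} →
             W w ≡ true →
             image (λ c → tp φ W w ρ (decode c ▷ σ)) ≡ image (λ c → tp φ W′ w′ ρ′ (decode c ▷ σ′)) →
             ∀ P → ∃[ Q ] tp φ W w ρ (P ▷ σ) ≡ tp φ W′ w′ ρ′ (Q ▷ σ′)
  set-move φ {W} {w} {W′} {w′} {ρ} {ρ′} {σ} {σ′} w∈ e P =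
    let c , q = image-⊆ (λ c → tp φ W w ρ (decode c ▷ σ)) (λ c → tp φ W′ w′ ρ′ (decode c ▷ σ′))
                  e (encode P)
    in decode c , trans (tp-set w∈ φ λ u _ → sym (decode-encode P u)) q

  -- The hypotheses say that a piece touches its complement only through its distinguished element,
  -- and that this element is related to the same outside elements in both pieces: to `K⁺` in the
  -- forward and from `K⁻` in the backward direction. Both sets avoid the pieces, so the pieces are
  -- unrelated to each other. Two sets are kept because incidence is not symmetric.
  module Swap (W : Bool → U A → Bool) (w : Bool → U A) (K⁺ K⁻ : U A → Bool)
    (w∈       : ∀ b → W b (w b) ≡ true)
    (disjoint : ∀ b {u} → W b u ≡ true → W (not b) u ≡ false)
    (K⁺-out   : ∀ b {u} → W b u ≡ true → K⁺ u ≡ false)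
    (K⁻-out   : ∀ b {u} → W b u ≡ true → K⁻ u ≡ false)
    (leaving  : ∀ b {u v} → W b u ≡ true → W b v ≡ false → relᵇ u v ≡ ⌊ u ≟ᵁ w b ⌋ ∧ K⁺ v)
    (entering : ∀ b {u v} → W b u ≡ true → W b v ≡ false → relᵇ v u ≡ ⌊ u ≟ᵁ w b ⌋ ∧ K⁻ v)
    where

    data Twin (a a′ : U A) : Set where
      inside  : ∀ b → W b a ≡ true → W (not b) a′ ≡ true → Twin a a′
      outside : (∀ b → W b a ≡ false) → a ≡ a′ → Twin a a′

    -- Two positions of the Ehrenfeucht–Fraïssé game in which the two pieces have changed roles.
    record Swapped {i j} (φ : Formula i j) (ρ ρ′ : Fin i → U A) (σ σ′ : Fin j → U A → Bool) : Set where
      constructor swapped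
      field
        twins : ∀ x → Twin (ρ x) (ρ′ x)
        sets  : ∀ X {u} → (∀ b → W b u ≡ false) → σ X u ≡ σ′ X u
        types : ∀ b → tp φ (W b) (w b) ρ σ ≡ tp φ (W (not b)) (w (not b)) ρ′ σ′
    open Swapped

    not² : ∀ b → W (not (not b)) ≡ W b
    not² b = cong W (𝔹.not-involutive b)

    twin-sym : ∀ {a a′} → Twin a a′ → Twin a′ a
    twin-sym (inside b p q)   = inside (not b) q (trans (cong (λ V → V _) (not² b)) p)
    twin-sym (outside p refl) = outside p refl

    swapped-sym : ∀ {i j} {φ : Formula i j} {ρ ρ′ σ σ′} → Swapped φ ρ ρ′ σ σ′ → Swapped φ ρ′ ρ σ′ σ
    swapped-sym {φ = φ} {ρ} {ρ′} {σ} {σ′} s = swapped (twin-sym ∘ twins s) (λ X o → sym (sets s X o)) flip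
      where
      flip : ∀ b → tp φ (W b) (w b) ρ′ σ′ ≡ tp φ (W (not b)) (w (not b)) ρ σ
      flip false = sym (types s true)
      flip true  = sym (types s false)

    ▷-twins : ∀ {i} {ρ ρ′ : Fin i → U A} {a a′} → Twin a a′ → (∀ x → Twin (ρ x) (ρ′ x)) →
              ∀ x → Twin ((a ▷ ρ) x) ((a′ ▷ ρ′) x)
    ▷-twins t ts zero    = t
    ▷-twins t ts (suc x) = ts x

    piece? : ∀ u → (∃[ b ] W b u ≡ true) ⊎ (∀ b → W b u ≡ false)
    piece? u with W false u in p | W true u in q
    ... | true  | _     = inj₁ (false , p)
    ... | false | true  = inj₁ (true , q)
    ... | false | false = inj₂ λ { false → p ; true → q }

    other-piece : ∀ b {c u} → W b u ≡ false → W c u ≡ true → c ≡ not b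
    other-piece false {false} p q = contradiction p (true≢false q)
    other-piece false {true}  p q = refl
    other-piece true  {false} p q = refl
    other-piece true  {true}  p q = contradiction p (true≢false q)

    twin-out : ∀ b {a a′} → Twin a a′ → W b a ≡ false → W (not b) a′ ≡ false
    twin-out b (inside c p q) o with other-piece b o p
    ... | refl = disjoint b (trans (cong (λ V → V _) (sym (not² b))) q)
    twin-out b (outside o refl) _ = o (not b)

    twin-in : ∀ b {a a′} → Twin a a′ → W b a ≡ true → W (not b) a′ ≡ true
    twin-in b {a′ = a′} t p with W (not b) a′ in q
    ... | true  = refl
    ... | false = contradiction
      (trans (sym (cong (λ V → V _) (not² b))) (twin-out (not b) (twin-sym t) q)) (true≢false p)

    agree-outside : (K : U A → Bool) → (∀ b {u} → W b u ≡ true → K u ≡ false) →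
                    ∀ {a a′} → Twin a a′ → K a ≡ K a′
    agree-outside K out (inside b p q)   = trans (out b p) (sym (out (not b) q))
    agree-outside K out (outside _ refl) = refl

    eq-transfer : ∀ {a a′ c c′} → Twin a a′ → Twin c c′ →
      (∀ b → bit (W b a ∧ W b c ∧ ⌊ a ≟ᵁ c ⌋) ≡ bit (W (not b) a′ ∧ W (not b) c′ ∧ ⌊ a′ ≟ᵁ c′ ⌋)) →
      a ≡ c → a′ ≡ c′
    eq-transfer (outside _ refl) (outside _ refl) e a≡c = a≡c
    eq-transfer (outside o refl) (inside b p _) e refl = contradiction (o b) (true≢false p)
    eq-transfer {a} {a′} {_} {c′} (inside b p q) t e refl =
      ⌊⌋-elim (proj₂ (∧-split {W (not b) c′} (proj₂ (∧-split {W (not b) a′} same))))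
      where
      same : W (not b) a′ ∧ W (not b) c′ ∧ ⌊ a′ ≟ᵁ c′ ⌋ ≡ true
      same = trans (sym (bit-injective (e b))) (∧-join p (∧-join p (⌊⌋-true {a? = a ≟ᵁ a} refl)))

    -- Inside one piece the types decide. Across a boundary the relation is determined by two things
    -- that twins share, being the distinguished element and belonging to `K⁺` or `K⁻`.
    rel-transfer : ∀ {a a′ c c′} → Twin a a′ → Twin c c′ →
      (∀ b → bit (W b a ∧ W b c ∧ relᵇ a c) ≡ bit (W (not b) a′ ∧ W (not b) c′ ∧ relᵇ a′ c′)) →
      (∀ b → bit ⌊ a ≟ᵁ w b ⌋ ≡ bit ⌊ a′ ≟ᵁ w (not b) ⌋) →
      (∀ b → bit ⌊ c ≟ᵁ w b ⌋ ≡ bit ⌊ c′ ≟ᵁ w (not b) ⌋) →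
      relᵇ a c ≡ relᵇ a′ c′
    rel-transfer {a} {a′} {c} {c′} s@(inside b p q) t e ra rc with W b c in r
    ... | true = begin
      relᵇ a c                                ≡⟨ cong₂ (λ x y → x ∧ y ∧ relᵇ a c) p r ⟨
      W b a ∧ W b c ∧ relᵇ a c                ≡⟨ bit-injective (e b) ⟩
      W (not b) a′ ∧ W (not b) c′ ∧ relᵇ a′ c′ ≡⟨ cong₂ (λ x y → x ∧ y ∧ relᵇ a′ c′) q (twin-in b t r) ⟩
      relᵇ a′ c′                              ∎
      where open ≡-Reasoning
    ... | false = begin
      relᵇ a c                       ≡⟨ leaving b p r ⟩
      ⌊ a ≟ᵁ w b ⌋ ∧ K⁺ c            ≡⟨ cong₂ _∧_ (bit-injective (ra b)) (agree-outside K⁺ K⁺-out t) ⟩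
      ⌊ a′ ≟ᵁ w (not b) ⌋ ∧ K⁺ c′    ≡⟨ leaving (not b) q (twin-out b t r) ⟨
      relᵇ a′ c′                     ∎
      where open ≡-Reasoning
    rel-transfer (outside _ refl) (outside _ refl) e ra rc = refl
    rel-transfer {a} {a′} {c} {c′} (outside o refl) (inside b p q) e ra rc = begin
      relᵇ a c                       ≡⟨ entering b p (o b) ⟩
      ⌊ c ≟ᵁ w b ⌋ ∧ K⁻ a            ≡⟨ cong (_∧ K⁻ a) (bit-injective (rc b)) ⟩
      ⌊ c′ ≟ᵁ w (not b) ⌋ ∧ K⁻ a     ≡⟨ entering (not b) q (o (not b)) ⟨
      relᵇ a c′                      ∎
      where open ≡-Reasoning

    mem-transfer : ∀ {a a′} (P Q : U A → Bool) → Twin a a′ →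
      (∀ b → bit (W b a ∧ P a) ≡ bit (W (not b) a′ ∧ Q a′)) →
      (∀ {u} → (∀ b → W b u ≡ false) → P u ≡ Q u) → P a ≡ true → Q a′ ≡ true
    mem-transfer P Q (inside b p q)   e o a∈ =
      proj₂ (∧-split (trans (sym (bit-injective (e b))) (∧-join p a∈)))
    mem-transfer P Q (outside x refl) e o a∈ = trans (sym (o x)) a∈

    -- A move outside both pieces is copied; a move inside a piece is answered by its type. In any
    -- pair of pieces where move and answer are outside, the type equality only yields some outside
    -- answer, which locality replaces by the actual one.
    elem-answer : ∀ {i j} (φ : Formula (suc i) j) {ρ ρ′ : Fin i → U A} {σ σ′ : Fin j → U A → Bool} →
      (∀ x → Twin (ρ x) (ρ′ x)) → (∀ X {u} → (∀ b → W b u ≡ false) → σ X u ≡ σ′ X u) →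
      (∀ b → image (tpElem φ (W b) (w b) ρ σ ∘ enum)
           ≡ image (tpElem φ (W (not b)) (w (not b)) ρ′ σ′ ∘ enum)) →
      ∀ a → ∃[ a′ ] Swapped φ (a ▷ ρ) (a′ ▷ ρ′) σ σ′
    elem-answer φ {ρ} {ρ′} {σ} {σ′} twins sets e a = answer (piece? a)
      where
      outside-types : ∀ {a′} b → W b a ≡ false → W (not b) a′ ≡ false →
        tp φ (W b) (w b) (a ▷ ρ) σ ≡ tp φ (W (not b)) (w (not b)) (a′ ▷ ρ′) σ′
      outside-types b o o′ with elem-move φ (e b) a
      ... | a″ , same , t = trans t (tp-outside (w∈ (not b)) φ (trans (sym same) o) o′)
      answer : (∃[ b ] W b a ≡ true) ⊎ (∀ b → W b a ≡ false) → ∃[ a′ ] Swapped φ (a ▷ ρ) (a′ ▷ ρ′) σ σ′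
      answer (inj₂ o) = a , swapped (▷-twins (outside o refl) twins) sets
        (λ b → outside-types b (o b) (o (not b)))
      answer (inj₁ (b , p)) with elem-move φ (e b) a
      ... | a′ , same , t = a′ , swapped (▷-twins twin twins) sets types′
        where
        twin : Twin a a′
        twin = inside b p (trans (sym same) p)
        types′ : ∀ c → tp φ (W c) (w c) (a ▷ ρ) σ ≡ tp φ (W (not c)) (w (not c)) (a′ ▷ ρ′) σ′
        types′ c with c 𝔹.≟ b
        ... | yes refl = t
        ... | no c≢b = outside-types c o (twin-out c twin o)
          where
          o : W c a ≡ false
          o = 𝔹.¬-not λ c∈ → true≢false c∈
            (trans (cong (λ c → W c a) (𝔹.¬-not c≢b)) (disjoint b p))

    -- The two pairs of pieces give two answers that need not agree. They can be glued because types
    -- see only the trace on a piece and the pieces are disjoint; elsewhere the move is copied.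
    set-answer : ∀ {i j} (φ : Formula i (suc j)) {ρ ρ′ : Fin i → U A} {σ σ′ : Fin j → U A → Bool} →
      (∀ x → Twin (ρ x) (ρ′ x)) → (∀ X {u} → (∀ b → W b u ≡ false) → σ X u ≡ σ′ X u) →
      (∀ b → image (λ c → tp φ (W b) (w b) ρ (decode c ▷ σ))
           ≡ image (λ c → tp φ (W (not b)) (w (not b)) ρ′ (decode c ▷ σ′))) →
      ∀ P → ∃[ Q ] Swapped φ ρ ρ′ (P ▷ σ) (Q ▷ σ′)
    set-answer φ {ρ} {ρ′} {σ} {σ′} twins sets e P = Q , swapped twins sets′ types′
      where
      move : ∀ b → ∃[ Q ] (tp φ (W b) (w b) ρ (P ▷ σ) ≡ tp φ (W (not b)) (w (not b)) ρ′ (Q ▷ σ′))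
      move b = set-move φ (w∈ b) (e b) P
      Q : U A → Bool
      Q u with piece? u
      -- The answer of `move b` is meant for the piece `not b`, so the piece `b` is served by
      -- `move (not b)`.
      ... | inj₁ (b , _) = proj₁ (move (not b)) u
      ... | inj₂ _       = P u
      Q-inside : ∀ b {u} → W (not b) u ≡ true → proj₁ (move b) u ≡ Q u
      Q-inside b {u} p with piece? u
      ... | inj₂ o = contradiction (o (not b)) (true≢false p)
      ... | inj₁ (c , q) with c 𝔹.≟ not b
      ... | yes refl = cong (λ b → proj₁ (move b) u) (sym (𝔹.not-involutive b))
      ... | no c≢ = contradiction
        (trans (cong (λ c → W c u) (𝔹.¬-not c≢)) (disjoint (not b) p)) (true≢false q)
      sets′ : ∀ X {u} → (∀ b → W b u ≡ false) → (P ▷ σ) X u ≡ (Q ▷ σ′) X u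
      sets′ (suc X) o = sets X o
      sets′ zero {u} o with piece? u
      ... | inj₁ (b , p) = contradiction (o b) (true≢false p)
      ... | inj₂ _       = refl
      types′ : ∀ b → tp φ (W b) (w b) ρ (P ▷ σ) ≡ tp φ (W (not b)) (w (not b)) ρ′ (Q ▷ σ′)
      types′ b = trans (proj₂ (move b)) (tp-set (w∈ (not b)) φ λ _ p → Q-inside b p)

    halves : ∀ {i j} (φ ψ : Formula i j) {ρ ρ′ : Fin i → U A} {σ σ′ : Fin j → U A → Bool} →
      (∀ x → Twin (ρ x) (ρ′ x)) → (∀ X {u} → (∀ b → W b u ≡ false) → σ X u ≡ σ′ X u) →
      (∀ b → tp (and φ ψ) (W b) (w b) ρ σ ≡ tp (and φ ψ) (W (not b)) (w (not b)) ρ′ σ′) →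
      Swapped φ ρ ρ′ σ σ′ × Swapped ψ ρ ρ′ σ σ′
    halves φ ψ {ρ} {ρ′} {σ} {σ′} twins sets e =
      swapped twins sets (proj₁ ∘ split) , swapped twins sets (proj₂ ∘ split)
      where
      split = λ b → F.combine-injective (tp φ (W b) (w b) ρ σ) _
                                        (tp φ (W (not b)) (w (not b)) ρ′ σ′) _ (e b)

    transfer : ∀ {i j} (φ : Formula i j) {ρ ρ′ : Fin i → U A} {σ σ′ : Fin j → U A → Bool} →
               Swapped φ ρ ρ′ σ σ′ → Sat A φ ρ σ → Sat A φ ρ′ σ′
    transfer (eq x y)  s p = eq-transfer (twins s x) (twins s y) (types s) p
    transfer (rel x y) s p = ⌊⌋-elim (trans (sym (rel-transfer (twins s x) (twins s y)
      (λ b → proj₁ (split b)) (λ b → proj₁ (split′ b)) (λ b → proj₂ (split′ b)))) (⌊⌋-true p))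
      where
      split  = λ b → F.combine-injective _ _ _ _ (types s b)
      split′ = λ b → F.combine-injective _ _ _ _ (proj₂ (split b))
    transfer (mem x X) {σ = σ} {σ′} s p = mem-transfer (σ X) (σ′ X) (twins s x) (types s) (sets s X) p
    -- The relation is symmetric, so a negation is refuted by transferring backwards. Rebuilding the
    -- record is enough, as `neg φ` has the same type as `φ`.
    transfer (neg φ)   s p q = p (transfer φ (swapped-sym (swapped (twins s) (sets s) (types s))) q)
    transfer (and φ ψ) s (p , q) =
      let l , r = halves φ ψ (twins s) (sets s) (types s) in transfer φ l p , transfer ψ r q
    transfer (or φ ψ)  s p =
      let l , r = halves φ ψ (twins s) (sets s) (types s) in Sum.map (transfer φ l) (transfer ψ r) p
    transfer (ex₁ φ)   s (a , p) =
      let a′ , s′ = elem-answer φ (twins s) (sets s) (types s) a in a′ , transfer φ s′ p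
    transfer (all₁ φ)  s p a′ =
      let s⁻ = swapped-sym s
          a , s′ = elem-answer φ (twins s⁻) (sets s⁻) (types s⁻) a′ in transfer φ (swapped-sym s′) (p a)
    transfer (ex₂ φ)   s (P , p) =
      let Q , s′ = set-answer φ (twins s) (sets s) (types s) P in Q , transfer φ s′ p
    transfer (all₂ φ)  s p Q =
      let s⁻ = swapped-sym s
          P , s′ = set-answer φ (twins s⁻) (sets s⁻) (types s⁻) Q in transfer φ (swapped-sym s′) (p P)

-- Exchanging two branches at the root

module Branching {A : Structure} (fin : FiniteDec A) (tree : RootedTree A) where
  open FiniteDec fin
  open RootedTree tree
  open Types fin

  branch : U A → U A → Bool
  branch w u = ⌊ anc? _≟ᵁ_ w u ⌋

  -- A branch is closed under children, so a pair leaving it must go up, and only its top has its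
  -- parent outside.
  branch-exit : ∀ {w u v} → root ◁ w → Anc w u → ¬ Anc w v → R A u v ⊎ R A v u → u ≡ w × v ≡ root
  branch-exit {w} {u} {v} rw wu ¬wv e = exit (Sum.[ rel⇒◁ , swap ∘ rel⇒◁ ]′ e)
    where
    exit : u ◁ v ⊎ v ◁ u → u ≡ w × v ≡ root
    exit (inj₁ uv) = contradiction (there wu uv) ¬wv
    exit (inj₂ vu) with anc-parent wu vu
    ... | inj₁ refl = refl , ◁-unique vu rw
    ... | inj₂ wv   = contradiction wv ¬wv

  module _ {k} (φ : Formula 2 k) (P : Fin k → U A → Bool) where

    -- The argument outside the branch is represented by `root`; by locality every outside element
    -- gives the same type. Both places are recorded because `w` may be the smaller or the larger
    -- argument.
    branchCode : U A → Fin (typeCount φ * typeCount φ)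
    branchCode w = F.combine (tp φ (branch w) w (w ▷ (root ▷ ε)) P)
                             (tp φ (branch w) w (root ▷ (w ▷ ε)) P)

    -- All children of the root are related to it alike. The constants will be `true`, `true` for
    -- adjacency and `false`, `true` for incidence.
    module _ (up down : Bool) (rel-up : ∀ {w} → root ◁ w → relᵇ w root ≡ up)
             (rel-down : ∀ {w} → root ◁ w → relᵇ root w ≡ down) where

      private
        module _ {w₁ w₂ : U A} (rw₁ : root ◁ w₁) (rw₂ : root ◁ w₂) (w₁≢w₂ : w₁ ≢ w₂) where

          w : Bool → U A
          w true  = w₁
          w false = w₂

          W : Bool → U A → Bool
          W b = branch (w b)

          rw : ∀ b → root ◁ w b
          rw true  = rw₁
          rw false = rw₂

          w-≢ : ∀ b → w b ≢ w (not b)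
          w-≢ true  = w₁≢w₂
          w-≢ false = w₁≢w₂ ∘ sym

          w∈ : ∀ b → W b (w b) ≡ true
          w∈ b = ⌊⌋-true here

          disjoint : ∀ b {u} → W b u ≡ true → W (not b) u ≡ false
          disjoint b p = ⌊⌋-false λ q →
            w-≢ b (siblings-separate (rw b) (rw (not b)) (⌊⌋-elim p) q)

          root-outside : ∀ b → W b root ≡ false
          root-outside b = ⌊⌋-false (◁-¬anc (rw b))

          atRoot : Bool → U A → Bool
          atRoot c u = ⌊ u ≟ᵁ root ⌋ ∧ c

          atRoot-out : ∀ c b {u} → W b u ≡ true → atRoot c u ≡ false
          atRoot-out c b {u} p with u ≟ᵁ root
          ... | yes refl = contradiction (root-outside b) (true≢false p)
          ... | no _     = refl

          boundary : (r : U A → U A → Bool) (c : Bool) →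
                     (∀ {u v} → r u v ≡ true → R A u v ⊎ R A v u) →
                     (∀ {w} → root ◁ w → r w root ≡ c) →
                     ∀ b {u v} → W b u ≡ true → W b v ≡ false → r u v ≡ ⌊ u ≟ᵁ w b ⌋ ∧ atRoot c v
          boundary r c sound const b {u} {v} p q with u ≟ᵁ w b | v ≟ᵁ root
          ... | yes refl | yes refl = const (rw b)
          ... | yes _ | no v≢ = 𝔹.¬-not λ e →
            v≢ (proj₂ (branch-exit (rw b) (⌊⌋-elim p) (⌊⌋-elim-false q) (sound e)))
          ... | no u≢ | _ = 𝔹.¬-not λ e →
            u≢ (proj₁ (branch-exit (rw b) (⌊⌋-elim p) (⌊⌋-elim-false q) (sound e)))

          open Swap W w (atRoot up) (atRoot down) w∈ disjoint (atRoot-out up) (atRoot-out down)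
            (boundary relᵇ up (inj₁ ∘ ⌊⌋-elim) rel-up)
            (boundary (λ u v → relᵇ v u) down (inj₂ ∘ ⌊⌋-elim) rel-down)

          other-outside : ∀ b → W b (w (not b)) ≡ false
          other-outside true  = disjoint false (w∈ false)
          other-outside false = disjoint true (w∈ true)

          swap-roots : branchCode w₁ ≡ branchCode w₂ →
                       Sat A φ (w₁ ▷ (w₂ ▷ ε)) P → Sat A φ (w₂ ▷ (w₁ ▷ ε)) P
          swap-roots e = transfer φ (swapped twins (λ _ _ → refl) types)
            where
            twins : ∀ x → Twin ((w₁ ▷ (w₂ ▷ ε)) x) ((w₂ ▷ (w₁ ▷ ε)) x)
            twins zero       = inside true (w∈ true) (w∈ false)
            twins (suc zero) = inside false (w∈ false) (w∈ true)

            own-first : ∀ b → tp φ (W b) (w b) (w b ▷ (w (not b) ▷ ε)) P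
                            ≡ tp φ (W b) (w b) (w b ▷ (root ▷ ε)) P
            own-first b = tp-local (w∈ b) φ
              (λ { zero → inj₁ refl ; (suc zero) → inj₂ (other-outside b , root-outside b) })
              (λ _ _ _ → refl)
            own-second : ∀ b → tp φ (W b) (w b) (w (not b) ▷ (w b ▷ ε)) P
                             ≡ tp φ (W b) (w b) (root ▷ (w b ▷ ε)) P
            own-second b = tp-local (w∈ b) φ
              (λ { zero → inj₂ (other-outside b , root-outside b) ; (suc zero) → inj₁ refl })
              (λ _ _ _ → refl)

            codes = F.combine-injective (tp φ (W true) w₁ (w₁ ▷ (root ▷ ε)) P) _
                                        (tp φ (W false) w₂ (w₂ ▷ (root ▷ ε)) P) _ e
            types : ∀ b → tp φ (W b) (w b) (w₁ ▷ (w₂ ▷ ε)) P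
                        ≡ tp φ (W (not b)) (w (not b)) (w₂ ▷ (w₁ ▷ ε)) P
            types true  = trans (own-first true) (trans (proj₁ codes) (sym (own-first false)))
            types false = trans (own-second false) (trans (sym (proj₂ codes)) (sym (own-second true)))

      branchCode-injective : IsTotalOrder _≡_ (λ a b → Sat A φ (a ▷ (b ▷ ε)) P) →
        ∀ {w₁ w₂} → root ◁ w₁ → root ◁ w₂ → branchCode w₁ ≡ branchCode w₂ → w₁ ≡ w₂
      branchCode-injective ord {w₁} {w₂} rw₁ rw₂ e with w₁ ≟ᵁ w₂
      ... | yes w₁≡w₂ = w₁≡w₂
      ... | no w₁≢w₂ with IsTotalOrder.total ord w₁ w₂
      ... | inj₁ p = IsTotalOrder.antisym ord p (swap-roots rw₁ rw₂ w₁≢w₂ e p)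
      ... | inj₂ p = IsTotalOrder.antisym ord (swap-roots rw₂ rw₁ (w₁≢w₂ ∘ sym) (sym e) p) p

-- Walks, distances and trees

least : ∀ (p : ℕ → Bool) k → p k ≡ true → ∃[ i ] (p i ≡ true × (∀ {j} → j < i → p j ≡ false))
least p k q with p zero in p₀
least p k       q | true  = zero , p₀ , λ ()
least p zero    q | false = contradiction p₀ (true≢false q)
least p (suc k) q | false with least (p ∘ suc) k q
... | i , pi , below = suc i , pi , λ { {zero} _ → p₀ ; {suc j} (s≤s j<i) → below j<i }

module Walks {n} (G : Graph n) (S : Fin n → Bool) where

  data Walk (u : Fin n) : Fin n → Set where
    stop : Walk u u
    step : ∀ {w v} → Walk u w → adjWithout G S w v ≡ true → Walk u v

  walk-++ : ∀ {u v w} → Walk u v → Walk v w → Walk u w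
  walk-++ p stop       = p
  walk-++ p (step q e) = step (walk-++ p q) e

  adjWithout-sym : ∀ {u v} → adjWithout G S u v ≡ true → adjWithout G S v u ≡ true
  adjWithout-sym {u} {v} e =
    let p , qr = ∧-split {not (S u)} e ; q , r = ∧-split {not (S v)} qr
    in ∧-join q (∧-join p (trans (adj-sym G v u) r))

  walk-sym : ∀ {u v} → Walk u v → Walk v u
  walk-sym stop       = stop
  walk-sym (step p e) = walk-++ (step stop (adjWithout-sym e)) (walk-sym p)

  reach⇒walk : ∀ k {u v} → reach G S k u v ≡ true → Walk u v
  reach⇒walk zero    q = subst (Walk _) (⌊⌋-elim q) stop
  reach⇒walk (suc k) {u} {v} q with ∨-split {reach G S k u v} q
  ... | inj₁ r = reach⇒walk k r
  ... | inj₂ r with any-elim _ r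
  ... | w , s = let p , e = ∧-split {reach G S k u w} s in step (reach⇒walk k p) e

  reach-suc : ∀ k {u v} → reach G S k u v ≡ true → reach G S (suc k) u v ≡ true
  reach-suc k q rewrite q = refl

  reach-step : ∀ k {u w v} → reach G S k u w ≡ true → adjWithout G S w v ≡ true →
               reach G S (suc k) u v ≡ true
  reach-step k {u} {w} {v} q e = ∨-inʳ (reach G S k u v)
    (any-intro (λ w → reach G S k u w ∧ adjWithout G S w v) {w} (∧-join q e))

  reach-mono : ∀ {k l u v} → k ≤′ l → reach G S k u v ≡ true → reach G S l u v ≡ true
  reach-mono (≤′-reflexive refl) q = q
  reach-mono {l = suc l} (≤′-step k≤l) q = reach-suc l (reach-mono k≤l q)

  Level : Fin n → ℕ → Fin n → Set
  Level u i v = reach G S i u v ≡ true × (∀ {j} → j < i → reach G S j u v ≡ false)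

  level-unique : ∀ {u i j v} → Level u i v → Level u j v → i ≡ j
  level-unique {i = i} {j} (p , p′) (q , q′) with ℕ.<-cmp i j
  ... | tri< i<j _ _ = contradiction (q′ i<j) (true≢false p)
  ... | tri≈ _ e _   = e
  ... | tri> _ _ j<i = contradiction (p′ j<i) (true≢false q)

  level-pred : ∀ {u i v} → Level u (suc i) v → ∃[ w ] (Level u i w × adjWithout G S w v ≡ true)
  level-pred {u} {i} {v} (q , below) with ∨-split {reach G S i u v} q
  ... | inj₁ r = contradiction (below ℕ.≤-refl) (true≢false r)
  ... | inj₂ r with any-elim _ r
  ... | w , s = let p , e = ∧-split {reach G S i u w} s in
    w , (p , λ {j} j<i → 𝔹.¬-not λ r → true≢false (reach-step j r e) (below (s≤s j<i))) , e

  level-below : ∀ {u m v} → Level u m v → ∀ {i} → i ≤′ m → ∃[ w ] Level u i w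
  level-below l (≤′-reflexive refl) = _ , l
  level-below l (≤′-step i≤m) = let w , l′ , _ = level-pred l in level-below l′ i≤m

  -- The vertices at distances 0, …, m from u are distinct.
  level-< : ∀ {u m v} → Level u m v → m < n
  level-< {u} {m} l = F.injective⇒≤ {f = proj₁ ∘ at} λ {i} {j} q →
    F.toℕ-injective (level-unique (proj₂ (at i)) (subst (Level u (toℕ j)) (sym q) (proj₂ (at j))))
    where
    at : (i : Fin (suc m)) → ∃[ w ] Level u (toℕ i) w
    at i = level-below l (ℕ.≤⇒≤′ (ℕ.≤-pred (F.toℕ<n i)))

  level : ∀ k u v → reach G S k u v ≡ true → ∃[ i ] Level u i v
  level k u v q = least (λ i → reach G S i u v) k q

  -- A vertex reachable at all has distance less than `n`. Hence the cutoff `n` in the definitions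
  -- of components and connectedness loses nothing.
  reach-saturated : ∀ k {u v} → reach G S k u v ≡ true → reach G S n u v ≡ true
  reach-saturated k q = let i , l = level k _ _ q in reach-mono (ℕ.≤⇒≤′ (ℕ.<⇒≤ (level-< l))) (proj₁ l)

  walk⇒reach : ∀ {u v} → Walk u v → reach G S n u v ≡ true
  walk⇒reach {u} stop   = reach-saturated 0 {u} (⌊⌋-true refl)
  walk⇒reach (step p e) = reach-saturated (suc n) (reach-step n (walk⇒reach p) e)

module _ {n} (G : Graph n) where
  edge-sym : ∀ {u v} → Edge G u v → Edge G v u
  edge-sym {u} {v} e = trans (adj-sym G v u) e

  data Path (u : Fin n) : Fin n → List (Fin n) → Set where
    single : Path u u (u ∷ [])
    cons   : ∀ {x w xs} → Edge G u x → Path x w xs → Path u w (u ∷ xs)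

  path-snoc : ∀ {u w x xs} → Path u w xs → Edge G w x → Path u x (xs ++ [ x ])
  path-snoc single     e = cons e single
  path-snoc (cons f p) e = cons f (path-snoc p e)

  path-linked : ∀ {u w xs} → Path u w xs → Linked (Edge G) xs
  path-linked single              = [-]
  path-linked (cons e single)     = e ∷ [-]
  path-linked (cons e (cons f p)) = e ∷ path-linked (cons f p)

  path-nonempty : ∀ {u w xs} → Path u w xs → 1 ≤ length xs
  path-nonempty single     = s≤s z≤n
  path-nonempty (cons _ _) = s≤s z≤n

finiteDecᴳ : ∀ {n} (G : Graph n) → FiniteDec ⌊ G ⌋ᴳ
finiteDecᴳ {n} G = record
  { size = n ; enum = λ v → v ; idx = λ v → v ; enum-idx = λ _ → refl
  ; rel? = λ u v → adj G u v 𝔹.≟ true }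

module Rooted {n} (G : Graph n) (connected : Connected G) (acyclic : Acyclic G) (r : Fin n) where
  open Walks G noVertex

  depth : Fin n → ℕ
  depth v = proj₁ (level n r v (connected r v))

  depth-level : ∀ v → Level r (depth v) v
  depth-level v = proj₂ (level n r v (connected r v))

  depth-zero : ∀ {v} → depth v ≡ 0 → v ≡ r
  depth-zero {v} q = sym (⌊⌋-elim (subst (λ k → reach G noVertex k r v ≡ true) q (proj₁ (depth-level v))))

  depth-root : depth r ≡ 0
  depth-root = level-unique (depth-level r) (⌊⌋-true refl , λ ())

  depth-edge : ∀ {u v} → Edge G u v → depth v ≤ suc (depth u)
  depth-edge {u} {v} e = ℕ.≮⇒≥ λ u<v →
    true≢false (reach-step (depth u) (proj₁ (depth-level u)) e) (proj₂ (depth-level v) u<v)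

  ascend : ∀ {k v} → depth v ≡ suc k → ∃[ w ] (depth w ≡ k × Edge G w v)
  ascend {k} {v} q =
    let w , l , e = level-pred (subst (λ k → Level r k v) q (depth-level v))
    in w , level-unique (depth-level w) l , e

  -- A simple path prepared for being closed to a cycle: `shallow` guarantees that vertices deeper
  -- than `k` can be attached without repetition, and `long` supplies the minimal length of a cycle.
  record Bridge (k : ℕ) (u w : Fin n) : Set where
    field
      vertices : List (Fin n)
      path     : Path G u w vertices
      unique   : Unique vertices
      shallow  : All (λ x → depth x ≤ k) vertices
      long     : u ≢ w → 3 ≤ length vertices
  open Bridge

  -- Two ascending paths from the same depth, joined where they first meet.
  bridge : ∀ k {u w} → depth u ≡ k → depth w ≡ k → Bridge k u w
  bridge k {u} {w} p q with u F.≟ w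
  ... | yes refl = record
    { vertices = u ∷ [] ; path = single ; unique = [] ∷ [] ; shallow = ℕ.≤-reflexive p ∷ []
    ; long = λ u≢u → contradiction refl u≢u }
  bridge zero p q | no u≢w = contradiction (trans (depth-zero p) (sym (depth-zero q))) u≢w
  bridge (suc k) {u} {w} p q | no u≢w with ascend p | ascend q
  ... | u′ , p′ , e | w′ , q′ , f = record
    { vertices = u ∷ vertices b ++ [ w ]
    ; path     = cons (edge-sym G e) (path-snoc G (path b) f)
    ; unique   = All.++⁺ (fresh p) (u≢w ∷ []) ∷ Unique.++⁺ (unique b) ([] ∷ [])
                   λ { (x∈ , here refl) → All.lookup (fresh q) x∈ refl }
    ; shallow  = ℕ.≤-reflexive p ∷ All.++⁺ (All.map ℕ.m≤n⇒m≤1+n (shallow b)) (ℕ.≤-reflexive q ∷ [])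
    ; long     = λ _ → s≤s (subst (2 ≤_) (sym (length-++ (vertices b)))
                   (ℕ.+-monoˡ-≤ 1 (path-nonempty G (path b))))
    }
    where
    b = bridge k p′ q′
    fresh : ∀ {x} → depth x ≡ suc k → All (x ≢_) (vertices b)
    fresh q = All.map (λ { y≤ refl → ℕ.1+n≰n (subst (_≤ k) q y≤) }) (shallow b)

  -- An edge within one level would close the bridge between its ends to a cycle.
  edge-depth-≢ : ∀ {u v} → Edge G u v → depth u ≢ depth v
  edge-depth-≢ {u} {v} e q = no-cycle (path b) (unique b) (long b λ { refl → true≢false e (adj-irrefl G u) })
    where
    b = bridge (depth u) refl (sym q)
    no-cycle : ∀ {xs} → Path G u v xs → Unique xs → ¬ 3 ≤ length xs
    no-cycle single       _    (s≤s ())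
    no-cycle p@(cons _ _) uniq (s≤s 2≤) =
      acyclic u _ (2≤ , uniq , path-linked G (path-snoc G p (edge-sym G e)))

  -- Two different parents are joined by a bridge no deeper than themselves. It avoids `v`, which
  -- closes it to a cycle.
  parent-unique : ∀ {u w v} → Edge G u v → Edge G w v →
                  depth v ≡ suc (depth u) → depth v ≡ suc (depth w) → u ≡ w
  parent-unique {u} {w} {v} e f p q with u F.≟ w
  ... | yes u≡w = u≡w
  ... | no u≢w = contradiction
    ( ℕ.≤-trans (ℕ.n≤1+n 2) (long b u≢w)
    , All.map (λ { y≤ refl → ℕ.1+n≰n (subst (_≤ depth u) p y≤) }) (shallow b) ∷ unique b
    , path-linked G (cons (edge-sym G e) (path-snoc G (path b) f)) )
    (acyclic v (vertices b))
    where
    b = bridge (depth u) refl (ℕ.suc-injective (trans (sym q) p))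

  -- The depth is a separate argument with an equation, so that `parentAt-spec` can match on it. At
  -- depth zero the value is a default.
  parentAt : ∀ k v → depth v ≡ k → Fin n
  parentAt zero    v q = r
  parentAt (suc k) v q = proj₁ (ascend q)

  parentAt-spec : ∀ {k l} v (q : depth v ≡ l) → l ≡ suc k →
                  depth (parentAt l v q) ≡ k × Edge G (parentAt l v q) v
  parentAt-spec v q refl = proj₂ (ascend q)

  parent : Fin n → Fin n
  parent v = parentAt (depth v) v refl

  parent-spec : ∀ {k v} → depth v ≡ suc k → depth (parent v) ≡ k × Edge G (parent v) v
  parent-spec {v = v} = parentAt-spec v refl

  rootedTree : RootedTree ⌊ G ⌋ᴳ
  rootedTree = record
    { root = r ; parent = parent ; depth = depth
    ; depth-root = depth-root ; depth-zero = depth-zero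
    ; depth-parent = λ q → proj₁ (parent-spec q)
    ; rel⇒◁ = orient
    ; ◁⇒rel = λ { (refl , q) → inj₁ (proj₂ (parent-spec q)) }
    }
    where
    child : ∀ {u v} → Edge G u v → depth v ≡ suc (depth u) → parent v ≡ u × depth v ≡ suc (depth u)
    child e q = let p , f = parent-spec q in parent-unique f e (trans q (cong suc (sym p))) q , q
    orient : ∀ {u v} → Edge G u v → (parent v ≡ u × depth v ≡ suc (depth u))
                                  ⊎ (parent u ≡ v × depth u ≡ suc (depth v))
    orient {u} {v} e with ℕ.<-cmp (depth u) (depth v)
    ... | tri< u<v _ _ = inj₁ (child e (ℕ.≤-antisym (depth-edge e) u<v))
    ... | tri≈ _ q _   = contradiction q (edge-depth-≢ e)
    ... | tri> _ _ v<u = inj₂ (child (edge-sym G e) (ℕ.≤-antisym (depth-edge (edge-sym G e)) v<u))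

-- Incidence structures

double : ℕ → ℕ
double zero    = zero
double (suc n) = suc (suc (double n))

module _ {n} (G : Graph n) where

  edge-≡ : ∀ {u v u′ v′} {p : u F.< v} {e : Edge G u v} {p′ : u′ F.< v′} {e′ : Edge G u′ v′} →
           u ≡ u′ → v ≡ v′ → _≡_ {A = EdgeOf G} ((u , v) , p , e) ((u′ , v′) , p′ , e′)
  edge-≡ refl refl = cong₂ (λ p e → _ , p , e) (ℕ.≤-irrelevant _ _) (Decidable⇒UIP.≡-irrelevant 𝔹._≟_ _ _)

  toEdge : ∀ {u v} → Edge G u v → EdgeOf G
  toEdge {u} {v} e with F.<-cmp u v
  ... | tri< u<v _ _  = (u , v) , u<v , e
  ... | tri≈ _ refl _ = contradiction (adj-irrefl G u) (true≢false e)
  ... | tri> _ _ v<u  = (v , u) , v<u , edge-sym G e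

  inc? : (x y : Fin n ⊎ EdgeOf G) → Dec (Inc G x y)
  inc? (inj₁ x) (inj₁ y)                 = no λ ()
  inc? (inj₁ x) (inj₂ ((u , v) , _ , _)) = (x F.≟ u) ⊎-dec (x F.≟ v)
  inc? (inj₂ x) y                        = no λ ()

  -- Pairs of vertices that are not of the form u < v with uv an edge enumerate r once more.
  finiteDecᴱ : Fin n → FiniteDec ⌈ G ⌉ᴳ
  finiteDecᴱ r = record
    { size = n + n * n ; enum = Sum.[ inj₁ , pairElem ∘ F.remQuot n ]′ ∘ F.splitAt n
    ; idx = idx ; enum-idx = enum-idx ; rel? = inc? }
    where
    pairElem : Fin n × Fin n → Fin n ⊎ EdgeOf G
    pairElem (u , v) with u F.<? v | adj G u v 𝔹.≟ true
    ... | yes u<v | yes e = inj₂ ((u , v) , u<v , e)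
    ... | _       | _     = inj₁ r
    pairElem-edge : ∀ {u v} (u<v : u F.< v) (e : Edge G u v) →
                    pairElem (u , v) ≡ inj₂ ((u , v) , u<v , e)
    pairElem-edge {u} {v} u<v e with u F.<? v | adj G u v 𝔹.≟ true
    ... | yes _  | yes _ = cong inj₂ (edge-≡ refl refl)
    ... | yes _  | no ¬e = contradiction e ¬e
    ... | no u≮v | _     = contradiction u<v u≮v
    idx : Fin n ⊎ EdgeOf G → Fin (n + n * n)
    idx (inj₁ v)                 = v F.↑ˡ (n * n)
    idx (inj₂ ((u , v) , _ , _)) = n F.↑ʳ F.combine u v
    enum-idx : ∀ x → Sum.[ inj₁ , pairElem ∘ F.remQuot n ]′ (F.splitAt n (idx x)) ≡ x
    enum-idx (inj₁ v) rewrite F.splitAt-↑ˡ n v (n * n) = refl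
    enum-idx (inj₂ ((u , v) , u<v , e)) rewrite F.splitAt-↑ʳ n (n * n) (F.combine u v) =
      trans (cong pairElem (F.remQuot-combine {n} u v)) (pairElem-edge u<v e)

-- Every non-root vertex hangs below the edge to its parent, which hangs below that parent.
module Incidence {n} (G : Graph n) (T : RootedTree ⌊ G ⌋ᴳ) where
  open RootedTree T

  -- An `EdgeOf` lists its ends in the order of `Fin n`; here they are sorted by depth, as the
  -- subdivided tree requires.
  record Ends (x : EdgeOf G) : Set where
    field
      upper lower : Fin n
      upper◁lower : upper ◁ lower
      inc⇒end     : ∀ {v} → Inc G (inj₁ v) (inj₂ x) → v ≡ upper ⊎ v ≡ lower
      upper-inc   : Inc G (inj₁ upper) (inj₂ x)
      lower-inc   : Inc G (inj₁ lower) (inj₂ x)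

  ends : ∀ x → Ends x
  ends ((u , v) , _ , e) with rel⇒◁ e
  ... | inj₁ uv = record { upper = u ; lower = v ; upper◁lower = uv ; inc⇒end = λ i → i
                         ; upper-inc = inj₁ refl ; lower-inc = inj₂ refl }
  ... | inj₂ vu = record { upper = v ; lower = u ; upper◁lower = vu ; inc⇒end = swap
                         ; upper-inc = inj₂ refl ; lower-inc = inj₁ refl }
  open module EndsOf x = Ends (ends x) public

  ◁-depth-≢ : ∀ {u v} → u ◁ v → ¬ v ◁ u
  ◁-depth-≢ uv vu = ◁-¬anc uv (there here vu)

  incident-edge : ∀ x {u v} → u ◁ v → Inc G (inj₁ u) (inj₂ x) → Inc G (inj₁ v) (inj₂ x) →
                  upper x ≡ u × lower x ≡ v
  incident-edge x uv i j with inc⇒end x i | inc⇒end x j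
  ... | inj₁ p    | inj₂ q    = sym p , sym q
  ... | inj₁ refl | inj₁ refl = contradiction uv (◁-depth-≢ uv)
  ... | inj₂ refl | inj₂ refl = contradiction uv (◁-depth-≢ uv)
  ... | inj₂ refl | inj₁ refl = contradiction (upper◁lower x) (◁-depth-≢ uv)

  toEdge-incˡ : ∀ {u v} (e : Edge G u v) → Inc G (inj₁ u) (inj₂ (toEdge G e))
  toEdge-incˡ {u} {v} e with F.<-cmp u v
  ... | tri< _ _ _    = inj₁ refl
  ... | tri≈ _ refl _ = contradiction (adj-irrefl G u) (true≢false e)
  ... | tri> _ _ _    = inj₂ refl

  toEdge-incʳ : ∀ {u v} (e : Edge G u v) → Inc G (inj₁ v) (inj₂ (toEdge G e))
  toEdge-incʳ {u} {v} e with F.<-cmp u v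
  ... | tri< _ _ _    = inj₂ refl
  ... | tri≈ _ refl _ = contradiction (adj-irrefl G u) (true≢false e)
  ... | tri> _ _ _    = inj₁ refl

  toEdge-ends : ∀ {u v} (e : Edge G u v) → u ◁ v → upper (toEdge G e) ≡ u × lower (toEdge G e) ≡ v
  toEdge-ends e uv = incident-edge (toEdge G e) uv (toEdge-incˡ e) (toEdge-incʳ e)

  -- The lower end has a unique parent, so it determines both ends. If the two edges listed them in
  -- opposite orders, `u<v` and `u<v′` would contradict each other.
  lower-injective : ∀ x y → lower x ≡ lower y → x ≡ y
  lower-injective x@((u , v) , u<v , e) y@((u′ , v′) , u<v′ , e′) q with rel⇒◁ e | rel⇒◁ e′
  ... | inj₁ uv | inj₁ uv′ = edge-≡ G (◁-unique uv (subst (_ ◁_) (sym q) uv′)) q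
  ... | inj₂ vu | inj₂ vu′ = edge-≡ G q (◁-unique vu (subst (_ ◁_) (sym q) vu′))
  ... | inj₁ uv | inj₂ vu′ with q | ◁-unique uv (subst (_ ◁_) (sym q) vu′)
  ... | refl | refl = contradiction u<v′ (F.<-asym u<v)
  lower-injective x@((u , v) , u<v , e) y@((u′ , v′) , u<v′ , e′) q | inj₂ vu | inj₁ uv′
    with q | ◁-unique vu (subst (_ ◁_) (sym q) uv′)
  ... | refl | refl = contradiction u<v′ (F.<-asym u<v)

  ◁-edge : ∀ {u v} → u ◁ v → Edge G u v
  ◁-edge uv = Sum.[ id , edge-sym G ]′ (◁⇒rel uv)

  parentᴱ : Fin n ⊎ EdgeOf G → Fin n ⊎ EdgeOf G
  parentᴱ (inj₁ v) = Sum.[ (λ _ → inj₁ root) , (λ p → inj₂ (toEdge G (◁-edge p))) ]′ (root-or-child v)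
  parentᴱ (inj₂ x) = inj₁ (upper x)

  depthᴱ : Fin n ⊎ EdgeOf G → ℕ
  depthᴱ (inj₁ v) = double (depth v)
  depthᴱ (inj₂ x) = suc (double (depth (upper x)))

  parent-lower : ∀ x → parentᴱ (inj₁ (lower x)) ≡ inj₂ x
  parent-lower x with root-or-child (lower x)
  ... | inj₁ q = contradiction (trans (sym (proj₂ (upper◁lower x))) (trans (cong depth q) depth-root)) λ ()
  ... | inj₂ p = cong inj₂ (lower-injective _ _ (proj₂ (toEdge-ends (◁-edge p) p)))

  depthᴱ-lower : ∀ x → depthᴱ (inj₁ (lower x)) ≡ suc (depthᴱ (inj₂ x))
  depthᴱ-lower x = cong double (proj₂ (upper◁lower x))

  double-suc : ∀ {m k} → double m ≡ suc k → 0 < m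
  double-suc {suc m} _ = s≤s z≤n

  child-of-edge : ∀ {v k} → depthᴱ (inj₁ v) ≡ suc k → ∃[ x ] (lower x ≡ v)
  child-of-edge {v} q with root-or-child v
  ... | inj₁ refl = contradiction depth-root (ℕ.>⇒≢ (double-suc q))
  ... | inj₂ p    = toEdge G (◁-edge p) , proj₂ (toEdge-ends (◁-edge p) p)

  incidenceTree : RootedTree ⌈ G ⌉ᴳ
  incidenceTree = record
    { root = inj₁ root ; parent = parentᴱ ; depth = depthᴱ
    ; depth-root = cong double depth-root ; depth-zero = depth-zeroᴱ
    ; depth-parent = λ {x} → depth-parentᴱ x
    ; rel⇒◁ = λ {x} {y} → rel⇒◁ᴱ x y ; ◁⇒rel = λ {x} {y} → ◁⇒relᴱ x y
    }
    where
    depth-zeroᴱ : ∀ {x} → depthᴱ x ≡ 0 → x ≡ inj₁ root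
    depth-zeroᴱ {inj₁ v} q with depth v in p
    ... | zero = cong inj₁ (depth-zero p)
    depth-parentᴱ : ∀ x {k} → depthᴱ x ≡ suc k → depthᴱ (parentᴱ x) ≡ k
    depth-parentᴱ (inj₂ x) q = ℕ.suc-injective q
    depth-parentᴱ (inj₁ v) q with child-of-edge q
    ... | x , refl = trans (cong depthᴱ (parent-lower x))
                       (ℕ.suc-injective (trans (sym (depthᴱ-lower x)) q))
    _◁ᴱ_ : (x y : Fin n ⊎ EdgeOf G) → Set
    x ◁ᴱ y = parentᴱ y ≡ x × depthᴱ y ≡ suc (depthᴱ x)
    rel⇒◁ᴱ : ∀ x y → Inc G x y → x ◁ᴱ y ⊎ y ◁ᴱ x
    rel⇒◁ᴱ (inj₁ v) (inj₂ x) i with inc⇒end x i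
    ... | inj₁ refl = inj₁ (refl , refl)
    ... | inj₂ refl = inj₂ (parent-lower x , depthᴱ-lower x)
    ◁⇒relᴱ : ∀ x y → x ◁ᴱ y → Inc G x y ⊎ Inc G y x
    ◁⇒relᴱ _ (inj₂ x) (refl , _) = inj₁ (upper-inc x)
    ◁⇒relᴱ _ (inj₁ v) (refl , q) with child-of-edge q
    ... | x , refl = inj₂ (subst (Inc G (inj₁ (lower x))) (sym (parent-lower x)) (lower-inc x))

  module _ (rank : Fin n → ℕ) (rank-injective : ∀ {x y z} → z ◁ x → z ◁ y → rank x ≡ rank y → x ≡ y) where
    private module T′ = RootedTree incidenceTree

    -- An edge has a single child, its lower end, so vertices can share the rank 0. The edges below
    -- a vertex correspond to its children and inherit their ranks.
    rankᴱ : Fin n ⊎ EdgeOf G → ℕ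
    rankᴱ (inj₁ v) = 0
    rankᴱ (inj₂ x) = rank (lower x)

    rankᴱ-injective : ∀ {x y z} → z T′.◁ x → z T′.◁ y → rankᴱ x ≡ rankᴱ y → x ≡ y
    rankᴱ-injective {inj₁ u} {inj₁ v} (p , r) (q , s) _ with child-of-edge r | child-of-edge s
    ... | x , refl | y , refl with trans (sym (parent-lower x)) (trans p (trans (sym q) (parent-lower y)))
    ... | refl = refl
    rankᴱ-injective {inj₁ u} {inj₂ y} (p , r) (refl , _) _ with child-of-edge r
    ... | x , refl = contradiction (trans (sym (parent-lower x)) p) λ ()
    rankᴱ-injective {inj₂ x} {inj₁ v} (refl , _) (q , s) _ with child-of-edge s
    ... | y , refl = contradiction (trans (sym (parent-lower y)) q) λ ()
    rankᴱ-injective {inj₂ x} {inj₂ y} (refl , _) (q , _) e with Sum.inj₁-injective q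
    ... | f = cong inj₂ (lower-injective x y
      (rank-injective (upper◁lower x) (subst (_◁ lower y) f (upper◁lower y)) e))

-- Separation and degree

module Components {n} (G : Graph n) (S : Fin n → Bool) where
  open Walks G S

  isLeast : Fin n → Bool
  isLeast v = not (S v) ∧ not (any (λ w → ⌊ w F.<? v ⌋ ∧ sameComp G S w v) (allFin n))

  adjWithout-elim : ∀ {u v} → adjWithout G S u v ≡ true → S u ≡ false × S v ≡ false × Edge G u v
  adjWithout-elim {u} {v} e =
    let p , qr = ∧-split {not (S u)} e ; q , r = ∧-split {not (S v)} qr in not-true p , not-true q , r

  adjWithout-intro : ∀ {u v} → S u ≡ false → S v ≡ false → Edge G u v → adjWithout G S u v ≡ true
  adjWithout-intro p q e = ∧-join (cong not p) (∧-join (cong not q) e)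

  isLeast-∉ : ∀ {v} → isLeast v ≡ true → S v ≡ false
  isLeast-∉ {v} l = not-true (proj₁ (∧-split {not (S v)} l))

  walk⇒sameComp : ∀ {u v} → S u ≡ false → S v ≡ false → Walk u v → sameComp G S u v ≡ true
  walk⇒sameComp u∉ v∉ p = ∧-join (cong not u∉) (∧-join (cong not v∉) (walk⇒reach p))

  isLeast-minimal : ∀ {x y} → isLeast x ≡ true → isLeast y ≡ true → Walk x y → ¬ x F.< y
  isLeast-minimal {x} {y} lx ly p x<y =
    true≢false (any-intro (λ w → ⌊ w F.<? y ⌋ ∧ sameComp G S w y) {x}
                 (∧-join (⌊⌋-true {a? = x F.<? y} x<y) (walk⇒sameComp (isLeast-∉ lx) (isLeast-∉ ly) p)))
               (not-true (proj₂ (∧-split {not (S y)} ly)))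

  isLeast-unique : ∀ {x y} → isLeast x ≡ true → isLeast y ≡ true → Walk x y → x ≡ y
  isLeast-unique {x} {y} lx ly p with F.<-cmp x y
  ... | tri< x<y _ _ = contradiction x<y (isLeast-minimal lx ly p)
  ... | tri≈ _ e _   = e
  ... | tri> _ _ y<x = contradiction y<x (isLeast-minimal ly lx (walk-sym p))

  private
    -- If `w` is not the least vertex of its component, a smaller one is reachable; `k` bounds the
    -- number of such descents.
    descend : ∀ k w → toℕ w < k → S w ≡ false → ∃[ x ] (isLeast x ≡ true × Walk x w)
    descend (suc k) w (s≤s w≤k) w∉ with any (λ v → ⌊ v F.<? w ⌋ ∧ sameComp G S v w) (allFin n) in q
    ... | false = w , ∧-join (cong not w∉) (cong not q) , stop
    ... | true with any-elim _ q
    ... | v , r =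
      let v<w , c     = ∧-split {⌊ v F.<? w ⌋} r
          v∉ , c′     = ∧-split {not (S v)} c
          _ , reached = ∧-split {not (S w)} c′
          x , lx , p  = descend k v (ℕ.<-≤-trans (⌊⌋-elim v<w) w≤k) (not-true v∉)
      in x , lx , walk-++ p (reach⇒walk n reached)

  leastOf : ∀ w → S w ≡ false → ∃[ x ] (isLeast x ≡ true × Walk x w)
  leastOf w = descend (suc (toℕ w)) w ℕ.≤-refl

  module _ (r : Fin n) where
    -- A walk from r into a component of G - S last enters it at r or right after a vertex of S.
    data Entrance (w : Fin n) : Set where
      atRoot : w ≡ r → Entrance w
      after  : ∀ {s} → S s ≡ true → Edge G s w → Entrance w

    entrance : ∀ {x} → Walks.Walk G noVertex r x → S x ≡ false → ∃[ w ] (Walk w x × Entrance w)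
    entrance Walks.stop x∉ = r , stop , atRoot refl
    entrance {x} (Walks.step {u} p e) x∉ with S u in q
    ... | true  = x , stop , after q e
    ... | false = let w , walk , en = entrance p q in w , step walk (adjWithout-intro q x∉ e) , en

    module _ {k d} (S≤k : ∣ S ∣ˢ ≤ k) (degree≤d : ∀ v → degree G v ≤ d) where

      -- One code is reserved for the root. The others are pairs of a vertex of `S`, at most `k` of
      -- them, and one of its at most `d` neighbours.
      entranceCode : ∀ {w} → Entrance w → Fin (suc (k * d))
      entranceCode (atRoot _)  = zero
      entranceCode (after {s} s∈ e) = suc (F.combine (code S S≤k s∈) (code (adj G s) (degree≤d s) e))

      entranceCode-injective : ∀ {w w′} (en : Entrance w) (en′ : Entrance w′) →
                               entranceCode en ≡ entranceCode en′ → w ≡ w′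
      entranceCode-injective (atRoot refl) (atRoot refl) q = refl
      entranceCode-injective (after {s} s∈ e) (after {s′} s′∈ e′) q
        with F.combine-injective (code S S≤k s∈) _ (code S S≤k s′∈) _ (F.suc-injective q)
      ... | p , p′ with code-injective S S≤k s∈ s′∈ p
      ... | refl = code-injective (adj G s) (degree≤d s) e e′ p′

      components-≤ : Connected G → components G S ≤ suc (k * d)
      components-≤ connected = countᵇ-≤ isLeast
        (λ x lx → entranceCode (proj₂ (proj₂ (enter x lx))))
        (λ {x} {y} lx ly q →
          let w , p , en   = enter x lx
              w′ , p′ , en′ = enter y ly
          in isLeast-unique lx ly (walk-++ (walk-sym p)
               (subst (λ w → Walk w y) (sym (entranceCode-injective en en′ q)) p′)))
        where
        enter : ∀ x → isLeast x ≡ true → ∃[ w ] (Walk w x × Entrance w)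
        enter x lx = entrance (Walks.reach⇒walk G noVertex n (connected r x))
          (isLeast-∉ lx)

module _ {n} (G : Graph n) (isTree : IsTree G) where

  treeAt : Fin n → RootedTree ⌊ G ⌋ᴳ
  treeAt = Rooted.rootedTree G (proj₁ (proj₂ isTree)) (proj₂ (proj₂ isTree))

  root-child : ∀ {v w} → Edge G v w → RootedTree._◁_ (treeAt v) v w
  root-child {v} e with RootedTree.rel⇒◁ (treeAt v) e
  ... | inj₁ vw = vw
  ... | inj₂ (_ , q) = contradiction (trans (sym q) (RootedTree.depth-root (treeAt v))) λ ()

  only : Fin n → Fin n → Bool
  only v u = ⌊ u F.≟ v ⌋

  only-size : ∀ v → ∣ only v ∣ˢ ≤ 1
  only-size v = countᵇ-≤ (only v) (λ _ _ → zero) λ p q _ → trans (⌊⌋-elim p) (sym (⌊⌋-elim q))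

  edge-≢ : ∀ {v w} → Edge G v w → only v w ≡ false
  edge-≢ {v} e = ⌊⌋-false λ { refl → true≢false e (adj-irrefl G v) }

  -- A walk avoiding the root cannot leave the branch it starts in.
  neighbours-separated : ∀ {v w w′} → Edge G v w → Edge G v w′ → Walks.Walk G (only v) w w′ → w ≡ w′
  neighbours-separated {v} {w} e e′ p = siblings-incomparable (root-child e) (root-child e′) (stays p)
    where
    open RootedTree (treeAt v)
    stays : ∀ {u} → Walks.Walk G (only v) w u → Anc w u
    stays Walks.stop = here
    stays (Walks.step {x} {y} p a) with Components.adjWithout-elim G (only v) {x} {y} a
    ... | _ , y≢v , xy with rel⇒◁ xy
    ... | inj₁ x◁y = there (stays p) x◁y
    ... | inj₂ y◁x with anc-parent (stays p) y◁x
    ... | inj₁ refl = contradiction (◁-unique y◁x (root-child e)) (⌊⌋-elim-false y≢v)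
    ... | inj₂ q    = q

  -- Each neighbour is coded by the least vertex of its component in the graph without `v`.
  degree-≤-components : ∀ v → degree G v ≤ components G (only v)
  degree-≤-components v = countᵇ-≤ (adj G v)
    (λ w e → let x , lx , _ = leastOf w (edge-≢ e) in code isLeast ℕ.≤-refl lx)
    (λ {w} {w′} e e′ q →
      let x , lx , p   = leastOf w (edge-≢ e)
          y , ly , p′ = leastOf w′ (edge-≢ e′)
      in neighbours-separated e e′ (walk-++ (walk-sym p)
           (subst (λ x → Walk x w′) (sym (code-injective isLeast ℕ.≤-refl lx ly q)) p′)))
    where
    open Components G (only v)
    open Walks G (only v)

  module _ {d} (degree≤d : ∀ v → degree G v ≤ d) (r : Fin n) where
    open RootedTree (treeAt r)

    -- The rank is taken among all neighbours of the parent, including the grandparent, so the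
    -- degree bounds it. At the root only the bound counts, and `position-≤` gives it even for
    -- non-members.
    siblingRank : Fin n → ℕ
    siblingRank v = rankIn (adj G (parent v)) v

    siblingRank-≤ : ∀ v → siblingRank v ≤ d
    siblingRank-≤ v = ℕ.≤-trans (position-≤ (adj G (parent v)) (allFin n) v) (degree≤d (parent v))

    siblingRank-injective : ∀ {x y z} → z ◁ x → z ◁ y → siblingRank x ≡ siblingRank y → x ≡ y
    siblingRank-injective {x} {y} zx@(refl , _) zy@(p , _) q = rankIn-injective (adj G (parent x))
      (child-edge zx) (child-edge zy) (trans q (cong (λ z → rankIn (adj G z) y) p))
      where
      child-edge : ∀ {z x} → z ◁ x → Edge G z x
      child-edge c = Sum.[ id , edge-sym G ]′ (◁⇒rel c)

    open Incidence G (treeAt r)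

    rankᴱ-≤ : ∀ x → rankᴱ siblingRank siblingRank-injective x ≤ d
    rankᴱ-≤ (inj₁ v) = z≤n
    rankᴱ-≤ (inj₂ x) = siblingRank-≤ (lower x)

    vertexOrder : ∃[ P ] IsTotalOrder _≡_ (λ a b → Sat ⌊ G ⌋ᴳ (orderF d) (a ▷ (b ▷ ε)) P)
    vertexOrder = _ , OrderSemantics.orderF-total (treeAt r) F._≟_ siblingRank
      (λ {x} → siblingRank-≤ x) siblingRank-injective

    incidenceOrder : ∃[ P ] IsTotalOrder _≡_ (λ a b → Sat ⌈ G ⌉ᴳ (orderF d) (a ▷ (b ▷ ε)) P)
    incidenceOrder = _ , OrderSemantics.orderF-total incidenceTree (FiniteDec._≟ᵁ_ (finiteDecᴱ G r))
      (rankᴱ siblingRank siblingRank-injective) (λ {x} → rankᴱ-≤ x)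
      (rankᴱ-injective siblingRank siblingRank-injective)

  module _ {k} (φ : Formula 2 k) (v : Fin n) where

    -- Rooting the tree at `v` itself turns its neighbours into the tops of the branches at the
    -- root.
    vertexOrder⇒degree-≤ : ∀ {P} → IsTotalOrder _≡_ (λ a b → Sat ⌊ G ⌋ᴳ φ (a ▷ (b ▷ ε)) P) →
                           degree G v ≤ typeCount φ * typeCount φ
    vertexOrder⇒degree-≤ {P} ord = countᵇ-≤ (adj G v) (λ w _ → branchCode φ P w)
      (λ e e′ → branchCode-injective φ P true true
        (λ vw → ⌊⌋-true (child-edge vw)) (λ vw → ⌊⌋-true (edge-sym G (child-edge vw)))
        ord (root-child e) (root-child e′))
      where
      open RootedTree (treeAt v)
      open Branching (finiteDecᴳ G) (treeAt v)
      child-edge : ∀ {w} → v ◁ w → Edge G w v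
      child-edge vw = Sum.[ edge-sym G , id ]′ (◁⇒rel vw)

    -- In the subdivided tree the children of `v` are its incident edges, so a neighbour is coded
    -- through the edge leading to it and recovered as the lower end.
    incidenceOrder⇒degree-≤ : ∀ {P} → IsTotalOrder _≡_ (λ a b → Sat ⌈ G ⌉ᴳ φ (a ▷ (b ▷ ε)) P) →
                              degree G v ≤ typeCount φ * typeCount φ
    incidenceOrder⇒degree-≤ {P} ord = countᵇ-≤ (adj G v) (λ w e → branchCode φ P (inj₂ (toEdge G e)))
      (λ {w} {w′} e e′ q → trans (sym (lower-edge e)) (trans (cong lower (Sum.inj₂-injective
          (branchCode-injective φ P false true (λ {w} → up {w}) (λ {w} → down {w}) ord
            (child e) (child e′) q)))
        (lower-edge e′)))
      where
      open Incidence G (treeAt v)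
      open RootedTree incidenceTree
      open Branching (finiteDecᴱ G v) incidenceTree
      open Types (finiteDecᴱ G v) using (relᵇ)
      upper-edge : ∀ {w} (e : Edge G v w) → upper (toEdge G e) ≡ v
      upper-edge e = proj₁ (toEdge-ends e (root-child e))
      lower-edge : ∀ {w} (e : Edge G v w) → lower (toEdge G e) ≡ w
      lower-edge e = proj₂ (toEdge-ends e (root-child e))
      child : ∀ {w} (e : Edge G v w) → inj₁ v ◁ inj₂ (toEdge G e)
      child e = cong inj₁ (upper-edge e) , cong (λ u → suc (depth (inj₁ u))) (upper-edge e)
      up : ∀ {w} → inj₁ v ◁ w → relᵇ w (inj₁ v) ≡ false
      up {w} _ = ⌊⌋-false (λ i → no-inc w i)
        where
        no-inc : ∀ w → ¬ Inc G w (inj₁ v)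
        no-inc (inj₁ _) ()
        no-inc (inj₂ _) ()
      down : ∀ {w} → inj₁ v ◁ w → relᵇ (inj₁ v) w ≡ true
      down {w} c with ◁⇒rel c
      ... | inj₁ i = ⌊⌋-true i
      ... | inj₂ i = contradiction i (λ i → no-inc w i)
        where
        no-inc : ∀ w → ¬ Inc G w (inj₁ v)
        no-inc (inj₁ _) ()
        no-inc (inj₂ _) ()

theorem4p8 : (C : GraphClass) → (∀ n G → C n G → IsTree G) →
    (MSO₁-orderable C ⇔ MSO₂-orderable C) × (MSO₁-orderable C ⇔ SEP C) ×
    (MSO₁-orderable C ⇔ BoundedDegree C)
theorem4p8 C tree =
    mk⇔ (bounded⇒MSO₂ ∘ MSO₁⇒bounded) (bounded⇒MSO₁ ∘ MSO₂⇒bounded)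
  , mk⇔ (bounded⇒SEP ∘ MSO₁⇒bounded) (bounded⇒MSO₁ ∘ SEP⇒bounded)
  , mk⇔ MSO₁⇒bounded bounded⇒MSO₁
  where
  MSO₁⇒bounded : MSO₁-orderable C → BoundedDegree C
  MSO₁⇒bounded (_ , φ , ord) = typeCount φ * typeCount φ , λ n G c v →
    -- The vertex `v` also serves as the element that makes the structure nonempty.
    vertexOrder⇒degree-≤ G (tree n G c) φ v (proj₂ (ord n G c v))

  MSO₂⇒bounded : MSO₂-orderable C → BoundedDegree C
  MSO₂⇒bounded (_ , φ , ord) = typeCount φ * typeCount φ , λ n G c v →
    incidenceOrder⇒degree-≤ G (tree n G c) φ v (proj₂ (ord n G c (inj₁ v)))

  bounded⇒MSO₁ : BoundedDegree C → MSO₁-orderable C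
  bounded⇒MSO₁ (d , bound) = _ , orderF d , λ n G c r →
    vertexOrder G (tree n G c) (bound n G c) r

  bounded⇒MSO₂ : BoundedDegree C → MSO₂-orderable C
  bounded⇒MSO₂ (d , bound) = _ , orderF d , λ n G c _ →
    -- The element at hand may be an edge, so the root comes from the clause `0 < n` of `IsTree`.
    incidenceOrder G (tree n G c) (bound n G c) (fromℕ< (proj₁ (tree n G c)))

  SEP⇒bounded : SEP C → BoundedDegree C
  SEP⇒bounded (f , sep) = f 1 , λ n G c v →
    ℕ.≤-trans (degree-≤-components G (tree n G c) v) (sep n G c 1 _ (only-size G (tree n G c) v))

  bounded⇒SEP : BoundedDegree C → SEP C
  bounded⇒SEP (d , bound) = (λ k → suc (k * d)) , λ n G c k S S≤k →
    Components.components-≤ G S (fromℕ< (proj₁ (tree n G c))) S≤k (bound n G c)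
      (proj₁ (proj₂ (tree n G c)))
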